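{- Let $n\ge 7$ be an integer. Every connected graph $G$ of order $n$ and size at most $2n$ has a foresty minimum vertex cut. Moreover, the bound is best possible: for every integer $n\ge 7$ there exists a connected graph of order $n$ and size $2n+1$ which has no foresty minimum vertex cut.
   Context: All graphs are finite and simple. The order of a graph is its number of vertices and the size is its number of edges. A vertex cut of a connected graph $G$ is a set $S\subset V(G)$ such that $G-S$ is disconnected. If $G$ has connectivity $k$, a vertex cut $S$ is called minimum if $|S|=k$. A vertex cut $S$ is called a foresty vertex cut if the induced subgraph $G[S]$ is a forest (acyclic). -}

module Defs where

open import Data.Fin.Base using (Fin; zero; suc; inject₁; fromℕ)
open import Data.Fin.Properties using (_<?_)
open import Data.Fin.Subset using (Subset; _∈_; ∁; ∣_∣)
open import Data.List.Base using (List; length; filter; allFin; cartesianProduct)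
open import Data.Nat.Base using (ℕ; _+_; _≤_)
open import Data.Product using (∃-syntax; _×_; _,_; proj₁)
open import Data.Sum using (_⊎_)
open import Function.Definitions using (Injective)
open import Level using (0ℓ)
open import Relation.Binary.Core using (Rel)
open import Relation.Binary.Construct.Closure.ReflexiveTransitive using (Star)
open import Relation.Binary.Definitions using (Decidable; Symmetric; Irreflexive)
open import Relation.Binary.PropositionalEquality using (_≡_; cong)
open import Relation.Nullary using (¬_)
open import Relation.Nullary.Decidable using (_×-dec_)

-- A simple graph on V; graphs of order n are taken on the vertex set Fin n.
record Graph (V : Set) : Set₁ where
  field
    _∼_    : Rel V 0ℓ
    _∼?_   : Decidable _∼_
    sym    : Symmetric _∼_
    irrefl : Irreflexive _≡_ _∼_

-- Each edge {u, v} is listed once, as the pair with u < v.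
edges : ∀ {n} → Graph (Fin n) → List (Fin n × Fin n)
edges {n} G = filter (λ (u , v) → (u <? v) ×-dec (u ∼? v)) (cartesianProduct (allFin n) (allFin n))
  where open Graph G

size : ∀ {n} → Graph (Fin n) → ℕ
size G = length (edges G)

-- G [ S ].  Membership in a Subset is proof-irrelevant, so the vertices of the
-- induced subgraph are exactly the elements of S, without repetition.
induced : ∀ {n} → Graph (Fin n) → (S : Subset n) → Graph (∃[ v ] v ∈ S)
induced G S = record
  { _∼_    = λ u v → proj₁ u ∼ proj₁ v
  ; _∼?_   = λ u v → proj₁ u ∼? proj₁ v
  ; sym    = sym
  ; irrefl = λ u≡v → irrefl (cong proj₁ u≡v)
  }
  where open Graph G

infixl 6 _-_

_-_ : ∀ {n} → Graph (Fin n) → (S : Subset n) → Graph (∃[ v ] v ∈ ∁ S)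
G - S = induced G (∁ S)

-- The graph with no vertices counts as connected, so the whole vertex set is
-- never a vertex cut.
Connected : ∀ {V} → Graph V → Set
Connected G = ∀ u v → Star (Graph._∼_ G) u v

Disconnected : ∀ {V} → Graph V → Set
Disconnected G = ¬ Connected G

-- A cycle c₀ ∼ c₁ ∼ ⋯ ∼ c₍ₖ₊₂₎ ∼ c₀ of length k + 3.
record Cycle {V : Set} (G : Graph V) : Set where
  open Graph G
  field
    k        : ℕ
    c        : Fin (3 + k) → V
    distinct : Injective _≡_ _≡_ c
    steps    : ∀ (i : Fin (2 + k)) → c (inject₁ i) ∼ c (suc i)
    closing  : c (fromℕ (2 + k)) ∼ c zero

Forest : ∀ {V} → Graph V → Set
Forest G = ¬ Cycle G

IsVertexCut : ∀ {n} → Graph (Fin n) → Subset n → Set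
IsVertexCut G S = Disconnected (G - S)

-- The standard definition of connectivity, which also covers complete graphs:
-- the least size of a set whose removal leaves a disconnected graph or a
-- single vertex.
Separates : ∀ {n} → Graph (Fin n) → Subset n → Set
Separates G S = Disconnected (G - S) ⊎ ∣ ∁ S ∣ ≡ 1

HasConnectivity : ∀ {n} → Graph (Fin n) → ℕ → Set
HasConnectivity G k =
  (∃[ S ] Separates G S × ∣ S ∣ ≡ k) × (∀ S → Separates G S → k ≤ ∣ S ∣)

IsMinimumVertexCut : ∀ {n} → Graph (Fin n) → Subset n → Set
IsMinimumVertexCut G S = IsVertexCut G S × HasConnectivity G ∣ S ∣

IsForestyVertexCut : ∀ {n} → Graph (Fin n) → Subset n → Set
IsForestyVertexCut G S = IsVertexCut G S × Forest (induced G S)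

HasForestyMinimumVertexCut : ∀ {n} → Graph (Fin n) → Set
HasForestyMinimumVertexCut G =
  ∃[ S ] IsMinimumVertexCut G S × IsForestyVertexCut G S

{-# OPTIONS --safe #-}
-- A minimum cut with at most two vertices, or with three vertices not forming a
-- triangle, is foresty.  If no set of at most two vertices separates G and all
-- separating triples are triangles, then the neighbourhood of a vertex of degree 3
-- is a triangle, and a discharging argument moving charge from the vertices of
-- degree ≥ 5 to those of degree 3 shows that size at most 2n forces G to be
-- 4-regular.  In that case no three vertices separate G, and a foresty cut of four
-- vertices is found next to a K₄ or as a neighbourhood: otherwise G would contain
-- two adjacent wheels, hence a closed octahedron, although n ≥ 7.
--
-- For sharpness, take the square of the cycle on n − 1 vertices, which is
-- 4-connected, and join a new vertex to three consecutive ones: these form a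
-- triangle and the only cut of three vertices.

module Submission where

open import Data.Bool.Base using (true; false; if_then_else_)
open import Data.Empty using (⊥)
open import Data.Fin.Base as Fin using (Fin; zero; suc; inject₁; fromℕ; fromℕ<; toℕ)
open import Data.Fin.Induction using (<-weakInduction)
import Data.Fin.Properties as Finₚ
open import Data.Fin.Properties using (any?; all?; toℕ-injective; sequence)
open import Data.Fin.Subset as Subset using (Subset; ∁; ∣_∣)
import Data.Fin.Subset.Properties as Subsetₚ
open import Data.List.Base using (List; []; _∷_; _++_; length; map; filter; allFin; tabulate; cartesianProduct)
open import Data.List.Membership.Propositional using (_∈_; _∉_)
import Data.List.Membership.DecPropositional as DecMembership
open import Data.List.Membership.Propositional.Properties using (∈-∃++; ∈-++⁺ˡ; ∈-++⁺ʳ; ∈-++⁻; ∈-filter⁺; ∈-filter⁻; ∈-allFin; ∈-tabulate⁻; ∈-map⁺; ∈-map⁻; ∈-cartesianProduct⁺)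
open import Data.List.Properties using (length-++; length-map; length-tabulate; map-++; map-∘)
open import Data.Nat.ListAction using (sum)
open import Data.Nat.ListAction.Properties using (sum-++)
open import Data.List.Relation.Unary.All as All using (All; []; _∷_)
open import Data.List.Relation.Unary.AllPairs using ([]; _∷_)
open import Data.List.Relation.Unary.Any using (here; there)
open import Data.List.Relation.Unary.Unique.Propositional using (Unique)
import Data.List.Relation.Unary.Unique.Propositional.Properties as Uniqueₚ
open import Data.Nat.Base using (ℕ; zero; suc; _+_; _*_; _∸_; _≤_; _<_; z≤n; s≤s; s≤s⁻¹)
open import Data.Nat.Properties hiding (_≟_; _<?_; _≤?_)
open import Data.Nat.Properties using () renaming (_≟_ to _≟ℕ_; _≤?_ to _≤?ℕ_)
open import Algebra.Properties.CommutativeSemigroup +-commutativeSemigroup using (interchange)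
open import Data.Product using (Σ-syntax; ∃-syntax; _×_; _,_; proj₁; proj₂)
open import Data.Sum using (_⊎_; inj₁; inj₂; [_,_]′)
open import Data.Vec.Base as Vec using ([]; _∷_)
import Data.Vec.Properties as Vecₚ
open import Data.Vec.Properties.WithK using ([]=-irrelevant)
open import Data.Nat.Solver using (module +-*-Solver)
open import Data.Product.Properties using (≡-dec)
open import Function.Base using (_∘_; id)
open import Relation.Binary.Construct.Closure.ReflexiveTransitive using (Star; ε; _◅_; _◅◅_)
open import Relation.Binary.PropositionalEquality using (_≡_; _≢_; refl; cong; cong₂; sym; trans; subst; module ≡-Reasoning)
open import Relation.Binary.Definitions using (tri<; tri≈; tri>)
open import Relation.Nullary using (¬_; Dec; yes; no; does; contradiction)
open import Relation.Nullary.Decidable using (_×-dec_; _→-dec_; ¬?; decidable-stable; toSum; map′; _⊎-dec_; ¬¬-excluded-middle)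
open import Relation.Unary using (Pred; Decidable)
open import Effect.Monad using (RawMonad)
open import Relation.Nullary.Negation using (¬¬-Monad)
open import Level using (0ℓ)
open import Defs

-- The local arguments share one device, `cut`: if some vertices have all their neighbours among at
-- most six listed vertices, then `7 ≤ n` leaves a vertex elsewhere, and the listed boundary
-- separates. Most configurations are excluded by finding such a boundary of two vertices.
-- Discharging must leave a strict surplus: the total charge is at most 0, so a positive remainder
-- at every vertex of degree at least 5 shows that there are none, and then nobody can pay a vertex
-- of degree 3. In sixths, a vertex of degree 5 owns 6 units and has to retain one. Three payments
-- of 2 or two payments of 3 would exhaust it, and exactly these cases need their own separating
-- pairs; from degree 6 on plain counting is enough. The case distinctions are constructive because
-- `Separated` asks for a bipartition, which a finite search can find, whereas `Disconnected` only
-- negates a statement about walks.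

pattern at0 = here refl
pattern at1 = there at0
pattern at2 = there at1
pattern at3 = there at2
pattern at4 = there at3
pattern at5 = there at4

-- Sums over lists

∑ : ∀ {A : Set} → List A → (A → ℕ) → ℕ
∑ xs f = sum (map f xs)

⟦_⟧ : ∀ {P : Set} → Dec P → ℕ
⟦ P? ⟧ = if does P? then 1 else 0

⟦⟧-yes : ∀ {P : Set} (P? : Dec P) → P → ⟦ P? ⟧ ≡ 1
⟦⟧-yes (yes _) _ = refl
⟦⟧-yes (no ¬p) p = contradiction p ¬p

⟦⟧-no : ∀ {P : Set} (P? : Dec P) → ¬ P → ⟦ P? ⟧ ≡ 0
⟦⟧-no (yes p) ¬p = contradiction p ¬p
⟦⟧-no (no _) _ = refl

⟦⟧≤1 : ∀ {P : Set} (P? : Dec P) → ⟦ P? ⟧ ≤ 1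
⟦⟧≤1 (yes _) = s≤s z≤n
⟦⟧≤1 (no _) = z≤n

module _ {A : Set} where

  ∑-++ : ∀ (xs ys : List A) f → ∑ (xs ++ ys) f ≡ ∑ xs f + ∑ ys f
  ∑-++ xs ys f = trans (cong sum (map-++ f xs ys)) (sum-++ (map f xs) (map f ys))

  ∑-mono : ∀ (xs : List A) {f g} → (∀ x → f x ≤ g x) → ∑ xs f ≤ ∑ xs g
  ∑-mono [] f≤g = z≤n
  ∑-mono (x ∷ xs) f≤g = +-mono-≤ (f≤g x) (∑-mono xs f≤g)

  ∑-cong : ∀ (xs : List A) {f g} → (∀ x → f x ≡ g x) → ∑ xs f ≡ ∑ xs g
  ∑-cong [] f≡g = refl
  ∑-cong (x ∷ xs) f≡g = cong₂ _+_ (f≡g x) (∑-cong xs f≡g)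

  ∑-+ : ∀ (xs : List A) f g → ∑ xs (λ x → f x + g x) ≡ ∑ xs f + ∑ xs g
  ∑-+ [] f g = refl
  ∑-+ (x ∷ xs) f g = trans (cong ((f x + g x) +_) (∑-+ xs f g)) (interchange (f x) (g x) (∑ xs f) (∑ xs g))

  ∑-*ˡ : ∀ (xs : List A) c f → ∑ xs (λ x → c * f x) ≡ c * ∑ xs f
  ∑-*ˡ [] c f = sym (*-zeroʳ c)
  ∑-*ˡ (x ∷ xs) c f = trans (cong (c * f x +_) (∑-*ˡ xs c f)) (sym (*-distribˡ-+ c (f x) (∑ xs f)))

  ∑-const : ∀ (xs : List A) c → ∑ xs (λ _ → c) ≡ length xs * c
  ∑-const [] c = refl
  ∑-const (x ∷ xs) c = cong (c +_) (∑-const xs c)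

  length-filter-∑ : ∀ {P : Pred A 0ℓ} (P? : Decidable P) xs → length (filter P? xs) ≡ ∑ xs (λ x → ⟦ P? x ⟧)
  length-filter-∑ P? [] = refl
  length-filter-∑ P? (x ∷ xs) with P? x
  ... | yes _ = cong suc (length-filter-∑ P? xs)
  ... | no _ = length-filter-∑ P? xs

  -- Deleting one occurrence of `x` from `ys` leaves a list that still contains `xs`, because `x`
  -- does not recur there.
  ∑-Unique-⊆ : ∀ {xs ys : List A} → Unique xs → (∀ {x} → x ∈ xs → x ∈ ys) → ∀ f → ∑ xs f ≤ ∑ ys f
  ∑-Unique-⊆ {[]} [] xs⊆ys f = z≤n
  ∑-Unique-⊆ {x ∷ xs} {ys} (x∉ ∷ uxs) xs⊆ys f with ∈-∃++ (xs⊆ys (here refl))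
  ... | ps , qs , refl = begin
    f x + ∑ xs f              ≤⟨ +-monoʳ-≤ (f x) (∑-Unique-⊆ uxs sub f) ⟩
    f x + ∑ (ps ++ qs) f      ≡⟨ cong (f x +_) (∑-++ ps qs f) ⟩
    f x + (∑ ps f + ∑ qs f)   ≡⟨ sym (+-assoc (f x) (∑ ps f) (∑ qs f)) ⟩
    f x + ∑ ps f + ∑ qs f     ≡⟨ cong (_+ ∑ qs f) (+-comm (f x) (∑ ps f)) ⟩
    ∑ ps f + f x + ∑ qs f     ≡⟨ +-assoc (∑ ps f) (f x) (∑ qs f) ⟩
    ∑ ps f + (f x + ∑ qs f)   ≡⟨ sym (∑-++ ps (x ∷ qs) f) ⟩
    ∑ (ps ++ x ∷ qs) f        ∎
    where
    open ≤-Reasoning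
    sub : ∀ {y} → y ∈ xs → y ∈ ps ++ qs
    sub y∈ with ∈-++⁻ ps (xs⊆ys (there y∈))
    ... | inj₁ y∈ps = ∈-++⁺ˡ y∈ps
    ... | inj₂ (here refl) = contradiction refl (All.lookup x∉ y∈)
    ... | inj₂ (there y∈qs) = ∈-++⁺ʳ ps y∈qs

  length-Unique-⊆ : ∀ {xs ys : List A} → Unique xs → (∀ {x} → x ∈ xs → x ∈ ys) → length xs ≤ length ys
  length-Unique-⊆ {xs} {ys} uxs xs⊆ys = begin
    length xs          ≡⟨ sym (trans (∑-const xs 1) (*-identityʳ _)) ⟩
    ∑ xs (λ _ → 1)     ≤⟨ ∑-Unique-⊆ uxs xs⊆ys (λ _ → 1) ⟩
    ∑ ys (λ _ → 1)     ≡⟨ trans (∑-const ys 1) (*-identityʳ _) ⟩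
    length ys          ∎
    where open ≤-Reasoning

∑-swap : ∀ {A B : Set} (xs : List A) (ys : List B) (f : A → B → ℕ) →
         ∑ xs (λ x → ∑ ys (f x)) ≡ ∑ ys (λ y → ∑ xs (λ x → f x y))
∑-swap [] ys f = sym (trans (∑-const ys 0) (*-zeroʳ (length ys)))
∑-swap (x ∷ xs) ys f =
  trans (cong (∑ ys (f x) +_) (∑-swap xs ys f)) (sym (∑-+ ys (f x) (λ y → ∑ xs (λ x → f x y))))

∑-cartesianProduct : ∀ {A B : Set} (xs : List A) (ys : List B) (f : A × B → ℕ) →
                     ∑ (cartesianProduct xs ys) f ≡ ∑ xs (λ x → ∑ ys (λ y → f (x , y)))
∑-cartesianProduct [] ys f = refl
∑-cartesianProduct (x ∷ xs) ys f = trans (∑-++ (map (x ,_) ys) _ f)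
  (cong₂ _+_ (cong sum (sym (map-∘ ys))) (∑-cartesianProduct xs ys f))

-- Finite sets of vertices as lists and as subsets

infix 4 _∈ˢ_ _∉ˢ_

_∈ˢ_ _∉ˢ_ : ∀ {n} → Fin n → Subset n → Set
_∈ˢ_ = Subset._∈_
_∉ˢ_ = Subset._∉_

module _ {n : ℕ} where

  open DecMembership (Finₚ._≟_ {n}) public using (_∈?_)

  ⟪_⟫ : ∀ {P : Pred (Fin n) 0ℓ} → Decidable P → Subset n
  ⟪ P? ⟫ = Vec.tabulate (does ∘ P?)

  ∈⟪⟫⁺ : ∀ {P : Pred (Fin n) 0ℓ} (P? : Decidable P) {x} → P x → x ∈ˢ ⟪ P? ⟫
  ∈⟪⟫⁺ P? {x} px with P? x in eq
  ... | yes _ = Vecₚ.lookup⇒[]= x ⟪ P? ⟫ (trans (Vecₚ.lookup∘tabulate (does ∘ P?) x) (cong does eq))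
  ... | no ¬p = contradiction px ¬p

  ∈⟪⟫⁻ : ∀ {P : Pred (Fin n) 0ℓ} (P? : Decidable P) {x} → x ∈ˢ ⟪ P? ⟫ → P x
  ∈⟪⟫⁻ P? {x} x∈ with P? x in eq
  ... | yes p = p
  ... | no _ with () ← trans (sym (cong does eq)) (trans (sym (Vecₚ.lookup∘tabulate (does ∘ P?) x)) (Vecₚ.[]=⇒lookup x∈))

  elements : Subset n → List (Fin n)
  elements S = filter (Subsetₚ._∈? S) (allFin n)

  ∈-elements⁺ : ∀ {S x} → x ∈ˢ S → x ∈ elements S
  ∈-elements⁺ {S} {x} = ∈-filter⁺ (Subsetₚ._∈? S) (∈-allFin x)

  ∈-elements⁻ : ∀ {S x} → x ∈ elements S → x ∈ˢ S
  ∈-elements⁻ {S} x∈ = proj₂ (∈-filter⁻ (Subsetₚ._∈? S) {xs = allFin n} x∈)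

  fromList : List (Fin n) → Subset n
  fromList L = ⟪ _∈? L ⟫

∑-tabulate : ∀ {A : Set} m (g : Fin m → A) (f : A → ℕ) → ∑ (tabulate g) f ≡ ∑ (allFin m) (f ∘ g)
∑-tabulate zero g f = refl
∑-tabulate (suc m) g f = cong (f (g zero) +_)
  (trans (∑-tabulate m (g ∘ suc) f) (sym (∑-tabulate m suc (f ∘ g))))

length-elements : ∀ {n} (S : Subset n) → length (elements S) ≡ ∣ S ∣
length-elements {n} S = trans (length-filter-∑ (Subsetₚ._∈? S) (allFin n)) (go S)
  where
  go : ∀ {n} (S : Subset n) → ∑ (allFin n) (λ x → ⟦ x Subsetₚ.∈? S ⟧) ≡ ∣ S ∣
  go [] = refl
  go {suc m} (s ∷ S) with s
  ... | true = cong suc (trans (∑-tabulate m suc _) (go S))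
  ... | false = trans (∑-tabulate m suc _) (go S)

length≤∣S∣ : ∀ {n} {S : Subset n} {L} → Unique L → (∀ {x} → x ∈ L → x ∈ˢ S) → length L ≤ ∣ S ∣
length≤∣S∣ {S = S} {L} uL L⊆S = subst (length L ≤_) (length-elements S) (length-Unique-⊆ uL (∈-elements⁺ ∘ L⊆S))

∣fromList∣≤length : ∀ {n} (L : List (Fin n)) → ∣ fromList L ∣ ≤ length L
∣fromList∣≤length {n} L = subst (_≤ length L) (length-elements (fromList L))
  (length-Unique-⊆ (Uniqueₚ.filter⁺ (Subsetₚ._∈? fromList L) (Uniqueₚ.allFin⁺ n)) (∈⟪⟫⁻ (_∈? L) ∘ ∈-elements⁻))

∃-∉ : ∀ {n} (L : List (Fin n)) → length L < n → ∃[ w ] w ∉ L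
∃-∉ {n} L L<n with any? (λ w → ¬? (w ∈? L))
... | yes w∉ = w∉
... | no none = contradiction L<n (≤⇒≯ (subst (_≤ length L) (length-tabulate {n = n} id)
        (length-Unique-⊆ (Uniqueₚ.allFin⁺ n) (λ {x} _ → decidable-stable (x ∈? L) (λ x∉ → none (x , x∉))))))

infix 4 _⊆_

_⊆_ : ∀ {n} → List (Fin n) → List (Fin n) → Set
xs ⊆ ys = ∀ {x} → x ∈ xs → x ∈ ys

-- An element `y` of `ys` outside `xs` would make `y ∷ xs` a duplicate-free list inside `ys` that is
-- too long. This turns a known degree into a complete list of neighbours.
⊆-reverse : ∀ {n} {xs ys : List (Fin n)} → Unique xs → xs ⊆ ys → length ys ≤ length xs → ys ⊆ xs
⊆-reverse {xs = xs} {ys} uxs xs⊆ys ys≤xs {y} y∈ys = decidable-stable (y ∈? xs) λ y∉xs →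
  contradiction ys≤xs (<⇒≱ (length-Unique-⊆ (All.tabulate (λ x∈ y≡x → y∉xs (subst (_∈ xs) (sym y≡x) x∈)) ∷ uxs)
    λ { (here refl) → y∈ys ; (there x∈) → xs⊆ys x∈ }))

-- Separations, vertex cuts and forests

module Separation {n : ℕ} (G : Graph (Fin n)) where
  open Graph G renaming (sym to ∼-sym; irrefl to ∼-irrefl) public

  ∼⇒≢ : ∀ {u v} → u ∼ v → u ≢ v
  ∼⇒≢ u∼v u≡v = ∼-irrefl u≡v u∼v

  -- A witness, decidable to search for, of the disconnectedness of G − P.  The
  -- side A may meet P.
  Separated : Pred (Fin n) 0ℓ → Set
  Separated P = ∃[ A ] (∃[ u ] u ∈ˢ A × ¬ P u) × (∃[ w ] w ∉ˢ A × ¬ P w)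
    × (∀ p q → p ∈ˢ A → ¬ P p → q ∉ˢ A → ¬ P q → ¬ p ∼ q)

  separated? : ∀ {P} → Decidable P → Dec (Separated P)
  separated? P? = Subsetₚ.anySubset? λ A →
    any? (λ u → (u Subsetₚ.∈? A) ×-dec ¬? (P? u)) ×-dec
    any? (λ w → ¬? (w Subsetₚ.∈? A) ×-dec ¬? (P? w)) ×-dec
    all? (λ p → all? λ q → (p Subsetₚ.∈? A) →-dec ¬? (P? p) →-dec ¬? (q Subsetₚ.∈? A) →-dec ¬? (P? q) →-dec ¬? (p ∼? q))

  Separated-cong : ∀ {P Q : Pred (Fin n) 0ℓ} → (∀ {x} → P x → Q x) → (∀ {x} → Q x → P x) → Separated P → Separated Q
  Separated-cong P⇒Q Q⇒P (A , (u , u∈ , ¬Pu) , (w , w∉ , ¬Pw) , cross) =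
    A , (u , u∈ , ¬Pu ∘ Q⇒P) , (w , w∉ , ¬Pw ∘ Q⇒P) ,
    λ p q p∈ ¬Qp q∉ ¬Qq → cross p q p∈ (¬Qp ∘ P⇒Q) q∉ (¬Qq ∘ P⇒Q)

  separate : ∀ {P A : Pred (Fin n) 0ℓ} → Decidable A → ∀ {u w} → A u → ¬ P u → ¬ A w → ¬ P w →
             (∀ {p q} → A p → ¬ P p → ¬ A q → ¬ P q → ¬ p ∼ q) → Separated P
  separate A? Au ¬Pu ¬Aw ¬Pw cross = ⟪ A? ⟫ , (_ , ∈⟪⟫⁺ A? Au , ¬Pu) , (_ , ¬Aw ∘ ∈⟪⟫⁻ A? , ¬Pw) ,
    λ p q p∈ ¬Pp q∉ ¬Pq → cross (∈⟪⟫⁻ A? p∈) ¬Pp (q∉ ∘ ∈⟪⟫⁺ A?) ¬Pq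

  -- The subset stored in `Separated` may contain arbitrary elements of `P`. Here the two sides
  -- partition the complement of `P` and enter symmetrically, so that `swap` carries every argument
  -- to the other side.
  record Split (P : Pred (Fin n) 0ℓ) : Set₁ where
    field
      I O : Pred (Fin n) 0ℓ
      I? : Decidable I
      O? : Decidable O
      I∩P : ∀ {p} → I p → ¬ P p
      O∩P : ∀ {p} → O p → ¬ P p
      I∩O : ∀ {p} → I p → ¬ O p
      I∪O : ∀ {p} → ¬ P p → I p ⊎ O p
      no-crossing : ∀ {p q} → I p → O q → ¬ p ∼ q
      u w : Fin n
      Iu : I u
      Ow : O w

  swap : ∀ {P} → Split P → Split P
  swap s = record
    { I = O ; O = I ; I? = O? ; O? = I? ; I∩P = O∩P ; O∩P = I∩P ; I∩O = λ Op Ip → I∩O Ip Op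
    ; I∪O = λ ¬Pp → [ inj₂ , inj₁ ]′ (I∪O ¬Pp) ; no-crossing = λ Op Iq p∼q → no-crossing Iq Op (∼-sym p∼q)
    ; u = w ; w = u ; Iu = Ow ; Ow = Iu }
    where open Split s

  Separated⇒Split : ∀ {P} → Decidable P → Separated P → Split P
  Separated⇒Split {P} P? (A , (u , u∈ , ¬Pu) , (w , w∉ , ¬Pw) , cross) = record
    { I = λ p → p ∈ˢ A × ¬ P p
    ; O = λ p → p ∉ˢ A × ¬ P p
    ; I? = λ p → (p Subsetₚ.∈? A) ×-dec ¬? (P? p)
    ; O? = λ p → ¬? (p Subsetₚ.∈? A) ×-dec ¬? (P? p)
    ; I∩P = proj₂ ; O∩P = proj₂ ; I∩O = λ (p∈ , _) (p∉ , _) → p∉ p∈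
    ; I∪O = λ {p} ¬Pp → [ (λ p∈ → inj₁ (p∈ , ¬Pp)) , (λ p∉ → inj₂ (p∉ , ¬Pp)) ]′ (toSum (p Subsetₚ.∈? A))
    ; no-crossing = λ (p∈ , ¬Pp) (q∉ , ¬Pq) → cross _ _ p∈ ¬Pp q∉ ¬Pq
    ; Iu = u∈ , ¬Pu ; Ow = w∉ , ¬Pw }

  Split⇒Separated : ∀ {P} → Split P → Separated P
  Split⇒Separated s = separate I? Iu (I∩P Iu) (λ Iw → I∩O Iw Ow) (O∩P Ow)
    λ Ip _ ¬Iq ¬Pq → [ (λ Iq → contradiction Iq ¬Iq) , no-crossing Ip ]′ (I∪O ¬Pq)
    where open Split s

  NoSeparatingPair TriangularCuts : Set
  NoSeparatingPair = ∀ L → length L ≤ 2 → ¬ Separated (_∈ L)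
  TriangularCuts = ∀ {a b c} → Separated (_∈ a ∷ b ∷ c ∷ []) → a ∼ b × b ∼ c × a ∼ c

  Separated⇒IsVertexCut : ∀ S → Separated (_∈ˢ S) → IsVertexCut G S
  Separated⇒IsVertexCut S (A , (u , u∈ , u∉S) , (w , w∉ , w∉S) , cross) conn =
    w∉ (stay (conn (u , Subsetₚ.x∉p⇒x∈∁p u∉S) (w , Subsetₚ.x∉p⇒x∈∁p w∉S)) u∈)
    where
    stay : ∀ {x y} → Star (Graph._∼_ (G - S)) x y → proj₁ x ∈ˢ A → proj₁ y ∈ˢ A
    stay ε x∈ = x∈
    stay {x} (_◅_ {j = y} x∼y y⋆z) x∈ = stay y⋆z (decidable-stable (proj₁ y Subsetₚ.∈? A) λ y∉ →
      cross (proj₁ x) (proj₁ y) x∈ (Subsetₚ.x∈∁p⇒x∉p (proj₂ x)) y∉ (Subsetₚ.x∈∁p⇒x∉p (proj₂ y)) x∼y)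

  -- Reachability is decidable up to ¬¬, which is enough since separatedness is stable.
  IsVertexCut⇒Separated : ∀ S → IsVertexCut G S → Separated (_∈ˢ S)
  IsVertexCut⇒Separated S disc = decidable-stable (separated? (Subsetₚ._∈? S)) λ ¬sep →
    ¬¬-∀Fin (λ u → ¬¬-∀Fin (λ w → ¬¬-excluded-middle {A = Reach u w})) λ reach? →
    disc λ { (u , u∉) (w , w∉) → connect ¬sep reach? u∉ w∉ }
    where
    Reach : Fin n → Fin n → Set
    Reach u w = Σ[ u∉ ∈ u ∈ˢ ∁ S ] Σ[ w∉ ∈ w ∈ˢ ∁ S ] Star (Graph._∼_ (G - S)) (u , u∉) (w , w∉)
    ¬¬-∀Fin : ∀ {P : Pred (Fin n) 0ℓ} → (∀ i → ¬ ¬ P i) → ¬ ¬ (∀ i → P i)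
    ¬¬-∀Fin = sequence (RawMonad.rawApplicative ¬¬-Monad)
    connect : ¬ Separated (_∈ˢ S) → (∀ u w → Dec (Reach u w)) → ∀ {u w} (u∉ : u ∈ˢ ∁ S) (w∉ : w ∈ˢ ∁ S) →
              Star (Graph._∼_ (G - S)) (u , u∉) (w , w∉)
    connect ¬sep reach? {u} {w} u∉ w∉ with reach? u w
    ... | yes (u∉′ , w∉′ , u⋆w) rewrite []=-irrelevant u∉ u∉′ | []=-irrelevant w∉ w∉′ = u⋆w
    ... | no ¬reach = contradiction
      (separate (reach? u) {u} {w} (u∉ , u∉ , ε) (Subsetₚ.x∈∁p⇒x∉p u∉) ¬reach (Subsetₚ.x∈∁p⇒x∉p w∉)
        (λ { (u∉′ , p∉ , u⋆p) _ ¬q q∉S p∼q → ¬q (u∉′ , Subsetₚ.x∉p⇒x∈∁p q∉S , u⋆p ◅◅ (p∼q ◅ ε)) }))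
      ¬sep

  module _ {S : Subset n} (cyc : Cycle (induced G S)) where
    open Cycle cyc

    point : Fin (3 + k) → Fin n
    point i = proj₁ (c i)

    point∈ : ∀ i → point i ∈ˢ S
    point∈ i = proj₂ (c i)

    point-injective : ∀ {i j} → point i ≡ point j → i ≡ j
    point-injective {i} {j} eq with c i in eqᵢ | c j in eqⱼ
    ... | x , x∈ | y , y∈ with eq
    ... | refl rewrite []=-irrelevant x∈ y∈ = distinct (trans eqᵢ (sym eqⱼ))

    cycle-length : ∀ {L} → (∀ {x} → x ∈ˢ S → x ∈ L) → 3 + k ≤ length L
    cycle-length {L} S⊆L = subst (_≤ length L) (length-tabulate point)
      (length-Unique-⊆ (Uniqueₚ.tabulate⁺ point-injective)
        λ x∈ → let (i , eq) = ∈-tabulate⁻ {f = point} x∈ in subst (_∈ L) (sym eq) (S⊆L (point∈ i)))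

  ∣S∣≤2⇒Forest : ∀ S → ∣ S ∣ ≤ 2 → Forest (induced G S)
  ∣S∣≤2⇒Forest S S≤2 cyc =
    contradiction (≤-trans (cycle-length cyc (∈-elements⁺ {S = S})) (subst (_≤ 2) (sym (length-elements S)) S≤2))
      λ { (s≤s (s≤s ())) }

  Clique : Subset n → Set
  Clique S = ∀ x y → x ∈ˢ S → y ∈ˢ S → x ≢ y → x ∼ y

  clique? : ∀ S → Dec (Clique S)
  clique? S = all? λ x → all? λ y → (x Subsetₚ.∈? S) →-dec (y Subsetₚ.∈? S) →-dec ¬? (x Finₚ.≟ y) →-dec (x ∼? y)

  -- A cycle inside three vertices is a triangle through all of them, which would make the set a
  -- clique.
  ¬Clique⇒Forest : ∀ S → ∣ S ∣ ≡ 3 → ¬ Clique S → Forest (induced G S)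
  ¬Clique⇒Forest S S≡3 ¬clique cyc@record { k = zero ; steps = steps ; closing = closing } =
    ¬clique λ x y x∈ y∈ x≢y → go (S⊆L x∈) (S⊆L y∈) x≢y
    where
    L = tabulate (point cyc)
    S⊆L : ∀ {x} → x ∈ˢ S → x ∈ L
    S⊆L x∈ = ⊆-reverse (Uniqueₚ.tabulate⁺ (point-injective cyc))
      (λ y∈ → let (i , eq) = ∈-tabulate⁻ {f = point cyc} y∈ in subst (_∈ elements S) (sym eq) (∈-elements⁺ (point∈ cyc i)))
      (≤-reflexive (trans (length-elements S) S≡3)) (∈-elements⁺ x∈)
    go : ∀ {x y} → x ∈ L → y ∈ L → x ≢ y → x ∼ y
    go at0 at0 x≢y = contradiction refl x≢y
    go at0 at1 x≢y = steps zero
    go at0 at2 x≢y = ∼-sym closing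
    go at1 at0 x≢y = ∼-sym (steps zero)
    go at1 at1 x≢y = contradiction refl x≢y
    go at1 at2 x≢y = steps (suc zero)
    go at2 at0 x≢y = closing
    go at2 at1 x≢y = ∼-sym (steps (suc zero))
    go at2 at2 x≢y = contradiction refl x≢y
  ¬Clique⇒Forest S S≡3 _ cyc@record { k = suc k } =
    contradiction (≤-trans (cycle-length cyc (∈-elements⁺ {S = S})) (≤-reflexive (trans (length-elements S) S≡3)))
      λ { (s≤s (s≤s (s≤s ()))) }

  Minimum : ℕ → Set
  Minimum m = ∀ S → Separated (_∈ˢ S) → m ≤ ∣ S ∣

  -- Descent: as long as a smaller separator exists, pass to it; `m` bounds the number of rounds.
  minimum-separator : ∀ m S → Separated (_∈ˢ S) → ∣ S ∣ ≤ m →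
                      ∃[ S′ ] Separated (_∈ˢ S′) × ∣ S′ ∣ ≤ m × Minimum ∣ S′ ∣
  minimum-separator m S sep S≤m
    with Subsetₚ.anySubset? (λ S′ → separated? (Subsetₚ._∈? S′) ×-dec (suc ∣ S′ ∣ ≤?ℕ ∣ S ∣))
  ... | no none = S , sep , S≤m , λ S′ sep′ → ≮⇒≥ λ lt → none (S′ , sep′ , lt)
  minimum-separator zero S sep S≤m | yes (S′ , sep′ , lt) = contradiction (≤-trans lt S≤m) λ ()
  minimum-separator (suc m) S sep S≤m | yes (S′ , sep′ , lt)
    with minimum-separator m S′ sep′ (s≤s⁻¹ (≤-trans lt S≤m))
  ... | S″ , sep″ , S″≤m , min = S″ , sep″ , m≤n⇒m≤1+n S″≤m , min

  ∣∁S∣≡1⇒6≤∣S∣ : 7 ≤ n → ∀ (S : Subset n) → ∣ ∁ S ∣ ≡ 1 → 6 ≤ ∣ S ∣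
  ∣∁S∣≡1⇒6≤∣S∣ 7≤n S eq = s≤s⁻¹ (begin
    7                  ≤⟨ 7≤n ⟩
    n                  ≤⟨ m≤n+m∸n n ∣ S ∣ ⟩
    ∣ S ∣ + (n ∸ ∣ S ∣)  ≡⟨ cong (∣ S ∣ +_) (trans (sym (Subsetₚ.∣∁p∣≡n∸∣p∣ S)) eq) ⟩
    ∣ S ∣ + 1            ≡⟨ +-comm ∣ S ∣ 1 ⟩
    1 + ∣ S ∣            ∎)
    where open ≤-Reasoning

  -- The bound 6 answers the second clause of `Separates`: as `7 ≤ n`, a set that leaves a single
  -- vertex has at least six elements.
  forestyMinimumVertexCut : 7 ≤ n → ∀ S → Separated (_∈ˢ S) → ∣ S ∣ ≤ 6 → Minimum ∣ S ∣ →
                            Forest (induced G S) → HasForestyMinimumVertexCut G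
  forestyMinimumVertexCut 7≤n S sep S≤6 min forest = S , (cut , (S , inj₁ cut , refl) , least) , cut , forest
    where
    cut = Separated⇒IsVertexCut S sep
    least : ∀ S′ → Separates G S′ → ∣ S ∣ ≤ ∣ S′ ∣
    least S′ (inj₁ disc) = min S′ (IsVertexCut⇒Separated S′ disc)
    least S′ (inj₂ eq) = ≤-trans S≤6 (∣∁S∣≡1⇒6≤∣S∣ 7≤n S′ eq)

-- Degrees, neighbour lists and the handshake lemma

∃-∈-avoiding : ∀ {n} {xs : List (Fin n)} → Unique xs → ∀ L → length L < length xs → ∃[ q ] q ∈ xs × All (q ≢_) L
∃-∈-avoiding {n} {xs} uxs L L<xs with any? (λ q → (q ∈? xs) ×-dec ¬? (q ∈? L))
... | yes (q , q∈ , q∉) = q , q∈ , All.tabulate λ x∈ q≡x → q∉ (subst (_∈ L) (sym q≡x) x∈)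
... | no none = contradiction L<xs (≤⇒≯ (length-Unique-⊆ uxs λ {x} x∈ →
        decidable-stable (x ∈? L) λ x∉ → none (x , x∈ , x∉)))

module Degree {n : ℕ} (G : Graph (Fin n)) where
  open Separation G public

  N : Fin n → List (Fin n)
  N p = filter (p ∼?_) (allFin n)

  deg : Fin n → ℕ
  deg p = length (N p)

  N-unique : ∀ p → Unique (N p)
  N-unique p = Uniqueₚ.filter⁺ (p ∼?_) (Uniqueₚ.allFin⁺ n)

  ∈N⁺ : ∀ {p q} → p ∼ q → q ∈ N p
  ∈N⁺ {p} {q} = ∈-filter⁺ (p ∼?_) (∈-allFin q)

  ∈N⁻ : ∀ {p q} → q ∈ N p → p ∼ q
  ∈N⁻ {p} q∈ = proj₂ (∈-filter⁻ (p ∼?_) {xs = allFin n} q∈)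

  length≤deg : ∀ {p L} → Unique L → All (p ∼_) L → length L ≤ deg p
  length≤deg uL adj = length-Unique-⊆ uL (∈N⁺ ∘ All.lookup adj)

  further-neighbour : ∀ p L → length L < deg p → ∃[ q ] p ∼ q × All (q ≢_) L
  further-neighbour p L L<deg with ∃-∈-avoiding (N-unique p) L L<deg
  ... | q , q∈ , q≢ = q , ∈N⁻ q∈ , q≢

  Cover : Fin n → List (Fin n) → Set
  Cover p L = ∀ {q} → p ∼ q → q ∈ L

  cover : ∀ {p L} → Unique L → All (p ∼_) L → deg p ≤ length L → Cover p L
  cover uL adj deg≤ p∼q = ⊆-reverse uL (∈N⁺ ∘ All.lookup adj) deg≤ (∈N⁺ p∼q)

  infixl 4 _▸_

  -- Used to rename a cover: the patterns `at0`, `at1` and so on give the position in `M` of each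
  -- entry of `L`.
  _▸_ : ∀ {p L M} → Cover p L → All (_∈ M) L → Cover p M
  (cov ▸ L⊆M) p∼q = All.lookup L⊆M (cov p∼q)

  size-∑ : size G ≡ ∑ (allFin n) (λ u → ∑ (allFin n) (λ v → ⟦ (u Finₚ.<? v) ×-dec (u ∼? v) ⟧))
  size-∑ = trans (length-filter-∑ _ (cartesianProduct (allFin n) (allFin n))) (∑-cartesianProduct (allFin n) (allFin n) _)

  handshake : ∑ (allFin n) deg ≤ 2 * size G
  handshake = begin
    ∑ V deg                                       ≤⟨ ∑-mono V split ⟩
    ∑ V (λ u → ∑ V (F u) + ∑ V (λ v → F v u))     ≡⟨ ∑-+ V _ _ ⟩
    ∑ V (λ u → ∑ V (F u)) + ∑ V (λ u → ∑ V (λ v → F v u)) ≡⟨ cong (∑ V (λ u → ∑ V (F u)) +_) (∑-swap V V (λ u v → F v u)) ⟩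
    ∑ V (λ u → ∑ V (F u)) + ∑ V (λ u → ∑ V (F u)) ≡⟨ cong₂ _+_ (sym size-∑) (sym size-∑) ⟩
    size G + size G                               ≡⟨ cong (size G +_) (sym (+-identityʳ (size G))) ⟩
    2 * size G                                    ∎
    where
    open ≤-Reasoning
    V = allFin n
    F : Fin n → Fin n → ℕ
    F u v = ⟦ (u Finₚ.<? v) ×-dec (u ∼? v) ⟧
    pair : ∀ u v → ⟦ u ∼? v ⟧ ≤ F u v + F v u
    pair u v with u ∼? v
    ... | no _ = z≤n
    ... | yes u∼v with Finₚ.<-cmp u v
    ... | tri< u<v _ _ = ≤-trans (≤-reflexive (sym (⟦⟧-yes ((u Finₚ.<? v) ×-dec yes u∼v) (u<v , u∼v)))) (m≤m+n _ (F v u))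
    ... | tri≈ _ u≡v _ = contradiction u≡v (∼⇒≢ u∼v)
    ... | tri> _ _ v<u = ≤-trans (≤-reflexive (sym (⟦⟧-yes ((v Finₚ.<? u) ×-dec (v ∼? u)) (v<u , ∼-sym u∼v)))) (m≤n+m (F v u) _)
    split : ∀ u → deg u ≤ ∑ V (F u) + ∑ V (λ v → F v u)
    split u = ≤-trans (≤-reflexive (length-filter-∑ (u ∼?_) V))
      (≤-trans (∑-mono V (pair u)) (≤-reflexive (∑-+ V (F u) (λ v → F v u))))

-- Local structure around vertices of degree 3

module Triangular {n : ℕ} (G : Graph (Fin n)) (7≤n : 7 ≤ n)
  (¬separated₂ : Separation.NoSeparatingPair G) (triangle : Separation.TriangularCuts G)
  where
  open Degree G public

  -- No edge leaves `u ∷ A` except into `L`, and the at most six vertices of `u ∷ A ++ L` miss some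
  -- `w` because `7 ≤ n`. So `L` separates `u` from `w`.
  cut : ∀ u A L → All (u ≢_) L → length (u ∷ A ++ L) ≤ 6 →
        All (λ p → Cover p (u ∷ A ++ L)) (u ∷ A) → Separated (_∈ L)
  cut u A L u∉L len covers with ∃-∉ (u ∷ A ++ L) (≤-trans (s≤s len) 7≤n)
  ... | w , w∉ = separate (_∈? (u ∷ A)) (here refl) (λ u∈L → All.lookup u∉L u∈L refl)
    (w∉ ∘ ∈-++⁺ˡ) (w∉ ∘ ∈-++⁺ʳ (u ∷ A))
    λ p∈ _ q∉A q∉L p∼q → [ q∉A , q∉L ]′ (∈-++⁻ (u ∷ A) (All.lookup covers p∈ p∼q))

  3≤deg : ∀ v → 3 ≤ deg v
  3≤deg v = ≰⇒> λ deg≤2 → ¬separated₂ (N v) deg≤2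
    (cut v [] (N v) (All.tabulate (∼⇒≢ ∘ ∈N⁻)) (≤-trans (s≤s deg≤2) (m≤m+n 3 3))
      ((λ v∼q → there (∈N⁺ v∼q)) ∷ []))

  record Deg₃ (v x y z : Fin n) : Set where
    field
      v∼x : v ∼ x
      v∼y : v ∼ y
      v∼z : v ∼ z
      covers : Cover v (x ∷ y ∷ z ∷ [])
      x∼y : x ∼ y
      y∼z : y ∼ z
      x∼z : x ∼ z

  deg₃-third : ∀ {v x y} → deg v ≡ 3 → v ∼ x → v ∼ y → x ≢ y → ∃[ z ] Deg₃ v x y z
  deg₃-third {v} {x} {y} deg≡3 v∼x v∼y x≢y
    with further-neighbour v (x ∷ y ∷ []) (≤-reflexive (sym deg≡3))
  ... | z , v∼z , z≢x ∷ z≢y ∷ [] = z , record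
    { v∼x = v∼x ; v∼y = v∼y ; v∼z = v∼z ; covers = cov
    ; x∼y = proj₁ clique ; y∼z = proj₁ (proj₂ clique) ; x∼z = proj₂ (proj₂ clique) }
    where
    cov : Cover v (x ∷ y ∷ z ∷ [])
    cov = cover ((x≢y ∷ z≢x ∘ sym ∷ []) ∷ (z≢y ∘ sym ∷ []) ∷ [] ∷ []) (v∼x ∷ v∼y ∷ v∼z ∷ []) (≤-reflexive deg≡3)
    clique = triangle (cut v [] (x ∷ y ∷ z ∷ []) (∼⇒≢ v∼x ∷ ∼⇒≢ v∼y ∷ ∼⇒≢ v∼z ∷ []) (m≤m+n 4 2) ((there ∘ cov) ∷ []))

  deg₃ : ∀ {v x} → deg v ≡ 3 → v ∼ x → ∃[ y ] ∃[ z ] Deg₃ v x y z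
  deg₃ {v} {x} deg≡3 v∼x with further-neighbour v (x ∷ []) (≤-trans (m≤m+n 2 1) (≤-reflexive (sym deg≡3)))
  ... | y , v∼y , y≢x ∷ [] = y , deg₃-third deg≡3 v∼x v∼y (y≢x ∘ sym)

  -- If `v ∼ u`, the triangle on the neighbours of `v` contains `u`, so both vertices have the same
  -- two further neighbours `x` and `y`, which cut off `u` and `v`.
  deg₃-independent : ∀ {u v} → deg u ≡ 3 → deg v ≡ 3 → ¬ v ∼ u
  deg₃-independent {u} {v} degu degv v∼u with deg₃ degv v∼u
  ... | x , y , D = ¬separated₂ (x ∷ y ∷ []) ≤-refl
      (cut v (u ∷ []) (x ∷ y ∷ []) (∼⇒≢ D.v∼y ∷ ∼⇒≢ D.v∼z ∷ []) (m≤m+n 4 2)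
        ((D.covers ▸ at1 ∷ at2 ∷ at3 ∷ []) ∷
         (cover ((∼⇒≢ D.v∼y ∷ ∼⇒≢ D.v∼z ∷ []) ∷ (∼⇒≢ D.y∼z ∷ []) ∷ [] ∷ [])
           (∼-sym v∼u ∷ D.x∼y ∷ D.x∼z ∷ []) (≤-reflexive degu) ▸ at0 ∷ at2 ∷ at3 ∷ []) ∷ []))
    where module D = Deg₃ D

  deg≡3⇒≢ : ∀ {u v} → deg u ≡ 3 → deg v ≢ 3 → u ≢ v
  deg≡3⇒≢ degu degv u≡v = degv (subst (λ z → deg z ≡ 3) u≡v degu)

  -- The surroundings of a vertex `v` of degree 3 with a neighbour `u` of degree 4: `v` and the
  -- fourth neighbour `u′` of `u` are both joined to the whole triangle `u x y`. Only the degree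
  -- bound on `x` is recorded; exchanging `x` and `y` gives the other one.
  record Diamond (v u x y u′ : Fin n) : Set where
    field
      star : Deg₃ v u x y
      u∼u′ : u ∼ u′
      u′≢v : u′ ≢ v
      u-covers : Cover u (u′ ∷ v ∷ x ∷ y ∷ [])
      u′∼x : u′ ∼ x
      u′∼y : u′ ∼ y
      degu′≢3 : deg u′ ≢ 3
      5≤degx : 5 ≤ deg x
    open Deg₃ star public renaming (v∼x to v∼u; v∼y to v∼x; v∼z to v∼y; covers to v-covers; x∼y to u∼x; y∼z to x∼y; x∼z to u∼y)

  -- The triple `u′ x y` cuts off `u` and `v`, hence is a triangle. If `u′` had degree 3, the pair
  -- `x y` would cut off `u`, `v` and `u′`. If `x` had only its four known neighbours, the pair
  -- `u′ y` would cut off `u`, `v` and `x`.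
  diamond : ∀ {v u x} → deg v ≡ 3 → deg u ≡ 4 → v ∼ u → v ∼ x → u ≢ x → ∃[ y ] ∃[ u′ ] Diamond v u x y u′
  diamond {v} {u} {x} degv degu v∼u v∼x u≢x with deg₃-third degv v∼u v∼x u≢x
  ... | y , D with further-neighbour u (v ∷ x ∷ y ∷ []) (≤-reflexive (sym degu))
  ... | u′ , u∼u′ , u′≢v ∷ u′≢x ∷ u′≢y ∷ [] = y , u′ , record
    { star = D ; u∼u′ = u∼u′ ; u′≢v = u′≢v ; u-covers = u-covers ; u′∼x = u′∼x ; u′∼y = u′∼y
    ; degu′≢3 = degu′≢3 ; 5≤degx = ≤∧≢⇒< (length≤deg x-unique x-adj) (degx≢4 ∘ sym) }
    where
    module D = Deg₃ D
    u-covers : Cover u (u′ ∷ v ∷ x ∷ y ∷ [])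
    u-covers = cover ((u′≢v ∷ u′≢x ∷ u′≢y ∷ []) ∷ (∼⇒≢ v∼x ∷ ∼⇒≢ D.v∼z ∷ []) ∷ (∼⇒≢ D.y∼z ∷ []) ∷ [] ∷ [])
      (u∼u′ ∷ ∼-sym v∼u ∷ D.x∼y ∷ D.x∼z ∷ []) (≤-reflexive degu)
    clique = triangle (cut u (v ∷ []) (u′ ∷ x ∷ y ∷ []) (∼⇒≢ u∼u′ ∷ u≢x ∷ ∼⇒≢ D.x∼z ∷ []) (m≤m+n 5 1)
      ((u-covers ▸ at2 ∷ at1 ∷ at3 ∷ at4 ∷ []) ∷ (D.covers ▸ at0 ∷ at3 ∷ at4 ∷ []) ∷ []))
    u′∼x = proj₁ clique
    u′∼y = proj₂ (proj₂ clique)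
    degu′≢3 : deg u′ ≢ 3
    degu′≢3 degu′ = ¬separated₂ (x ∷ y ∷ []) ≤-refl
      (cut u (v ∷ u′ ∷ []) (x ∷ y ∷ []) (u≢x ∷ ∼⇒≢ D.x∼z ∷ []) (m≤m+n 5 1)
        ((u-covers ▸ at2 ∷ at1 ∷ at3 ∷ at4 ∷ []) ∷ (D.covers ▸ at0 ∷ at3 ∷ at4 ∷ []) ∷
         (cover ((u≢x ∷ ∼⇒≢ D.x∼z ∷ []) ∷ (∼⇒≢ D.y∼z ∷ []) ∷ [] ∷ []) (∼-sym u∼u′ ∷ u′∼x ∷ u′∼y ∷ []) (≤-reflexive degu′)
           ▸ at0 ∷ at3 ∷ at4 ∷ []) ∷ []))
    x-unique : Unique (u′ ∷ u ∷ v ∷ y ∷ [])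
    x-unique = (∼⇒≢ u∼u′ ∘ sym ∷ u′≢v ∷ u′≢y ∷ []) ∷ (∼⇒≢ v∼u ∘ sym ∷ ∼⇒≢ D.x∼z ∷ []) ∷ (∼⇒≢ D.v∼z ∷ []) ∷ [] ∷ []
    x-adj : All (x ∼_) (u′ ∷ u ∷ v ∷ y ∷ [])
    x-adj = ∼-sym u′∼x ∷ ∼-sym D.x∼y ∷ ∼-sym v∼x ∷ D.y∼z ∷ []
    degx≢4 : deg x ≢ 4
    degx≢4 degx = ¬separated₂ (u′ ∷ y ∷ []) ≤-refl
      (cut u (v ∷ x ∷ []) (u′ ∷ y ∷ []) (∼⇒≢ u∼u′ ∷ ∼⇒≢ D.x∼z ∷ []) (m≤m+n 5 1)
        ((u-covers ▸ at3 ∷ at1 ∷ at2 ∷ at4 ∷ []) ∷ (D.covers ▸ at0 ∷ at2 ∷ at4 ∷ []) ∷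
         (cover x-unique x-adj (≤-reflexive degx) ▸ at3 ∷ at0 ∷ at1 ∷ at4 ∷ []) ∷ []))

  N₃ : Fin n → List (Fin n)
  N₃ x = filter (λ v → (x ∼? v) ×-dec (deg v ≟ℕ 3)) (allFin n)

  N₃-unique : ∀ x → Unique (N₃ x)
  N₃-unique x = Uniqueₚ.filter⁺ (λ v → (x ∼? v) ×-dec (deg v ≟ℕ 3)) (Uniqueₚ.allFin⁺ n)

  ∈N₃⁻ : ∀ {x v} → v ∈ N₃ x → x ∼ v × deg v ≡ 3
  ∈N₃⁻ {x} v∈ = proj₂ (∈-filter⁻ (λ v → (x ∼? v) ×-dec (deg v ≟ℕ 3)) {xs = allFin n} v∈)

  N₃-bound : ∀ {x K} → Unique K → All (λ k → x ∼ k × deg k ≢ 3) K → length K + length (N₃ x) ≤ deg x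
  N₃-bound {x} {K} uK adj = subst (_≤ deg x) (length-++ K)
    (length≤deg (Uniqueₚ.++⁺ uK (N₃-unique x)
        λ { (k∈K , k∈N₃) → proj₂ (All.lookup adj k∈K) (proj₂ (∈N₃⁻ k∈N₃)) })
      (All.tabulate λ y∈ → [ (λ y∈K → proj₁ (All.lookup adj y∈K)) , (λ y∈N₃ → proj₁ (∈N₃⁻ y∈N₃)) ]′ (∈-++⁻ K y∈)))

  -- The neighbourhood of `v` is a triangle through `x`, so every other neighbour of `v` is a
  -- neighbour of `x` and occurs in `L`; the last hypothesis discards the impossible entries.
  deg₃-covers : ∀ {v x L} → deg v ≡ 3 → v ∼ x → Cover x L → ∀ M →
                (∀ {q} → v ∼ q → q ∈ L → q ∈ M) → Cover v (x ∷ M)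
  deg₃-covers {v} {x} degv v∼x x-covers M L⇒M {q} v∼q with x Finₚ.≟ q
  ... | yes refl = here refl
  ... | no x≢q = there (L⇒M v∼q (x-covers (Deg₃.x∼y (proj₂ (deg₃-third degv v∼x v∼q x≢q)))))

  module _ {v u x y u′ : Fin n} (degv : deg v ≡ 3) (degu : deg u ≡ 4) (D : Diamond v u x y u′) where
    open Diamond D

    degu≢3 : deg u ≢ 3
    degu≢3 eq with () ← trans (sym eq) degu

    degy≢3 : deg y ≢ 3
    degy≢3 degy = deg₃-independent degy degv v∼y

    diamond-N₃ : 3 + length (N₃ x) ≤ deg x
    diamond-N₃ = N₃-bound ((∼⇒≢ u∼y ∷ ∼⇒≢ u∼u′ ∷ []) ∷ (∼⇒≢ u′∼y ∘ sym ∷ []) ∷ [] ∷ [])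
      ((∼-sym u∼x , degu≢3) ∷ (x∼y , degy≢3) ∷ (∼-sym u′∼x , degu′≢3) ∷ [])

    -- A second neighbour `v₂` of degree 3 would complete the neighbours of `x` to `v₂ u v y u′`.
    -- Since `v₂` is adjacent neither to `u`, whose neighbours are known, nor to `v`, the pair
    -- `y u′` would cut off `x`, `v`, `u` and `v₂`.
    diamond-N₃-5 : deg x ≡ 5 → length (N₃ x) ≤ 1
    diamond-N₃-5 degx = ≮⇒≥ λ 1<N₃ → absurd (∃-∈-avoiding (N₃-unique x) (v ∷ []) 1<N₃)
      where
      absurd : ¬ (∃[ v₂ ] v₂ ∈ N₃ x × All (v₂ ≢_) (v ∷ []))
      absurd (v₂ , v₂∈ , v₂≢v ∷ []) = ¬separated₂ (y ∷ u′ ∷ []) ≤-refl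
        (cut x (v ∷ u ∷ v₂ ∷ []) (y ∷ u′ ∷ []) (∼⇒≢ x∼y ∷ ∼⇒≢ u′∼x ∘ sym ∷ []) ≤-refl
          ((x-covers ▸ at3 ∷ at2 ∷ at1 ∷ at4 ∷ at5 ∷ []) ∷
           (v-covers ▸ at2 ∷ at0 ∷ at4 ∷ []) ∷
           (u-covers ▸ at5 ∷ at1 ∷ at0 ∷ at4 ∷ []) ∷
           (deg₃-covers degv₂ (∼-sym x∼v₂) x-covers (y ∷ u′ ∷ []) prune ▸ at0 ∷ at4 ∷ at5 ∷ []) ∷ []))
        where
        x∼v₂ = proj₁ (∈N₃⁻ v₂∈)
        degv₂ = proj₂ (∈N₃⁻ v₂∈)
        v₂≢u = deg≡3⇒≢ degv₂ degu≢3
        v₂≢y = deg≡3⇒≢ degv₂ degy≢3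
        v₂≢u′ = deg≡3⇒≢ degv₂ degu′≢3
        x-covers : Cover x (v₂ ∷ u ∷ v ∷ y ∷ u′ ∷ [])
        x-covers = cover ((v₂≢u ∷ v₂≢v ∷ v₂≢y ∷ v₂≢u′ ∷ []) ∷ (∼⇒≢ v∼u ∘ sym ∷ ∼⇒≢ u∼y ∷ ∼⇒≢ u∼u′ ∷ [])
            ∷ (∼⇒≢ v∼y ∷ u′≢v ∘ sym ∷ []) ∷ (∼⇒≢ u′∼y ∘ sym ∷ []) ∷ [] ∷ [])
          (x∼v₂ ∷ ∼-sym u∼x ∷ ∼-sym v∼x ∷ x∼y ∷ ∼-sym u′∼x ∷ []) (≤-reflexive degx)
        prune : ∀ {q} → v₂ ∼ q → q ∈ v₂ ∷ u ∷ v ∷ y ∷ u′ ∷ [] → q ∈ y ∷ u′ ∷ []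
        prune v₂∼q at0 = contradiction refl (∼⇒≢ v₂∼q)
        prune v₂∼u at1 with u-covers (∼-sym v₂∼u)
        ... | at0 = contradiction refl v₂≢u′
        ... | at1 = contradiction refl v₂≢v
        ... | at2 = contradiction refl (∼⇒≢ x∼v₂)
        ... | at3 = contradiction refl v₂≢y
        prune v₂∼v at2 = contradiction v₂∼v (deg₃-independent degv degv₂)
        prune _ at3 = at0
        prune _ at4 = at1

  module _ {v x : Fin n} (degv : deg v ≡ 3) (v∼x : v ∼ x) where

    N₃-bound-2 : 2 + length (N₃ x) ≤ deg x
    N₃-bound-2 with deg₃ degv v∼x
    ... | p , q , D = N₃-bound ((∼⇒≢ D.y∼z ∷ []) ∷ [] ∷ [])
        ((D.x∼y , λ degp → deg₃-independent degp degv D.v∼y) ∷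
         (D.x∼z , λ degq → deg₃-independent degq degv D.v∼z) ∷ [])
      where module D = Deg₃ D

    -- With three neighbours of degree 3, the vertex `x` has only `p` and `q` besides them. As these
    -- three are pairwise non-adjacent, each has neighbours `x`, `p`, `q`, and the pair `p q` would
    -- cut off all three together with `x`.
    N₃-bound-5 : deg x ≡ 5 → length (N₃ x) ≤ 2
    N₃-bound-5 degx = ≮⇒≥ λ 2<N₃ → absurd 2<N₃
      where
      absurd : ¬ 3 ≤ length (N₃ x)
      absurd 3≤N₃ with ∃-∈-avoiding (N₃-unique x) (v ∷ []) (≤-trans (m≤m+n 2 1) 3≤N₃) | deg₃ degv v∼x
      ... | v₂ , v₂∈ , v₂≢v ∷ [] | p , q , D with ∃-∈-avoiding (N₃-unique x) (v₂ ∷ v ∷ []) 3≤N₃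
      ... | v₃ , v₃∈ , v₃≢v₂ ∷ v₃≢v ∷ [] = ¬separated₂ (p ∷ q ∷ []) ≤-refl
        (cut x (v ∷ v₂ ∷ v₃ ∷ []) (p ∷ q ∷ []) (∼⇒≢ D.x∼y ∷ ∼⇒≢ D.x∼z ∷ []) ≤-refl
          ((x-covers ▸ at3 ∷ at2 ∷ at1 ∷ at4 ∷ at5 ∷ []) ∷
           (D.covers ▸ at0 ∷ at4 ∷ at5 ∷ []) ∷ light degv₂ x∼v₂ ∷ light degv₃ x∼v₃ ∷ []))
        where
        module D = Deg₃ D
        x∼v₂ = proj₁ (∈N₃⁻ v₂∈)
        degv₂ = proj₂ (∈N₃⁻ v₂∈)
        x∼v₃ = proj₁ (∈N₃⁻ v₃∈)
        degv₃ = proj₂ (∈N₃⁻ v₃∈)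
        degp≢3 : deg p ≢ 3
        degp≢3 degp = deg₃-independent degp degv D.v∼y
        degq≢3 : deg q ≢ 3
        degq≢3 degq = deg₃-independent degq degv D.v∼z
        x-covers : Cover x (v₃ ∷ v₂ ∷ v ∷ p ∷ q ∷ [])
        x-covers = cover ((v₃≢v₂ ∷ v₃≢v ∷ deg≡3⇒≢ degv₃ degp≢3 ∷ deg≡3⇒≢ degv₃ degq≢3 ∷ []) ∷
            (v₂≢v ∷ deg≡3⇒≢ degv₂ degp≢3 ∷ deg≡3⇒≢ degv₂ degq≢3 ∷ []) ∷
            (∼⇒≢ D.v∼y ∷ ∼⇒≢ D.v∼z ∷ []) ∷ (∼⇒≢ D.y∼z ∷ []) ∷ [] ∷ [])
          (x∼v₃ ∷ x∼v₂ ∷ ∼-sym v∼x ∷ D.x∼y ∷ D.x∼z ∷ []) (≤-reflexive degx)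
        light : ∀ {z} → deg z ≡ 3 → x ∼ z → Cover z (x ∷ v ∷ v₂ ∷ v₃ ∷ p ∷ q ∷ [])
        light {z} degz x∼z = deg₃-covers degz (∼-sym x∼z) x-covers (p ∷ q ∷ []) prune ▸ at0 ∷ at4 ∷ at5 ∷ []
          where
          prune : ∀ {r} → z ∼ r → r ∈ v₃ ∷ v₂ ∷ v ∷ p ∷ q ∷ [] → r ∈ p ∷ q ∷ []
          prune z∼r at0 = contradiction z∼r (deg₃-independent degv₃ degz)
          prune z∼r at1 = contradiction z∼r (deg₃-independent degv₂ degz)
          prune z∼r at2 = contradiction z∼r (deg₃-independent degv degz)
          prune _ at3 = at0
          prune _ at4 = at1

-- Discharging to 4-regularity

module Discharging {n : ℕ} (G : Graph (Fin n)) (7≤n : 7 ≤ n)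
  (¬separated₂ : Separation.NoSeparatingPair G) (triangle : Separation.TriangularCuts G)
  (size≤2n : size G ≤ 2 * n)
  where
  open Triangular G 7≤n ¬separated₂ triangle public

  Special : Fin n → Set
  Special v = ∃[ u ] v ∼ u × deg u ≡ 4

  special? : ∀ v → Dec (Special v)
  special? v = any? λ u → (v ∼? u) ×-dec (deg u ≟ℕ 4)

  Light : Fin n → Fin n → Set
  Light v x = deg v ≡ 3 × v ∼ x × 5 ≤ deg x

  light? : ∀ v x → Dec (Light v x)
  light? v x = (deg v ≟ℕ 3) ×-dec (v ∼? x) ×-dec (5 ≤?ℕ deg x)

  -- Six times the charge that v receives from x: vertices start with charge
  -- deg − 4, and a vertex of degree 3 collects 1/3 from each neighbour, or 1/2
  -- from each of the other two if one of its neighbours has degree 4.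
  charge : Fin n → Fin n → ℕ
  charge v x = ⟦ light? v x ⟧ * (2 + ⟦ special? v ⟧)

  charge-light : ∀ {v x} → Light v x → charge v x ≡ 2 + ⟦ special? v ⟧
  charge-light {v} {x} light = trans (cong (_* (2 + ⟦ special? v ⟧)) (⟦⟧-yes (light? v x) light)) (*-identityˡ _)

  charge-¬light : ∀ {v x} → ¬ Light v x → charge v x ≡ 0
  charge-¬light {v} {x} ¬light = cong (_* (2 + ⟦ special? v ⟧)) (⟦⟧-no (light? v x) ¬light)

  received sent : Fin n → ℕ
  received v = ∑ (allFin n) (charge v)
  sent x = ∑ (allFin n) (λ v → charge v x)

  ∑-zero : ∀ {f} → (∀ i → f i ≡ 0) → ∑ (allFin n) f ≡ 0
  ∑-zero f≡0 = trans (∑-cong (allFin n) f≡0) (trans (∑-const (allFin n) 0) (*-zeroʳ (length (allFin n))))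

  sent≤ : ∀ x c → (∀ {v} → Light v x → 2 + ⟦ special? v ⟧ ≤ c) → sent x ≤ c * length (N₃ x)
  sent≤ x c bound = begin
    sent x                                  ≤⟨ ∑-mono (allFin n) pointwise ⟩
    ∑ (allFin n) (λ v → c * ⟦ in? v ⟧)      ≡⟨ ∑-*ˡ (allFin n) c (λ v → ⟦ in? v ⟧) ⟩
    c * ∑ (allFin n) (λ v → ⟦ in? v ⟧)      ≡⟨ cong (c *_) (sym (length-filter-∑ in? (allFin n))) ⟩
    c * length (N₃ x)                       ∎
    where
    open ≤-Reasoning
    in? : ∀ v → Dec (x ∼ v × deg v ≡ 3)
    in? v = (x ∼? v) ×-dec (deg v ≟ℕ 3)
    pointwise : ∀ v → charge v x ≤ c * ⟦ in? v ⟧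
    pointwise v with light? v x
    ... | no ¬light = subst (_≤ c * ⟦ in? v ⟧) (sym (charge-¬light ¬light)) z≤n
    ... | yes light@(degv , v∼x , _) = ≤-trans (≤-reflexive (charge-light light)) (≤-trans (bound light)
          (≤-reflexive (sym (trans (cong (c *_) (⟦⟧-yes (in? v) (∼-sym v∼x , degv))) (*-identityʳ c)))))

  heavy-neighbour : ∀ {v x} → deg v ≡ 3 → v ∼ x → deg x ≢ 4 → 5 ≤ deg x
  heavy-neighbour {v} {x} degv v∼x degx≢4 =
    ≤∧≢⇒< (≤∧≢⇒< (3≤deg x) λ 3≡degx → deg₃-independent (sym 3≡degx) degv v∼x) (degx≢4 ∘ sym)

  6≤received-special : ∀ {v} → deg v ≡ 3 → Special v → 6 ≤ received v
  6≤received-special {v} degv special@(u , v∼u , degu)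
    with further-neighbour v (u ∷ []) (≤-trans (m≤m+n 2 1) (≤-reflexive (sym degv)))
  ... | x , v∼x , x≢u ∷ [] with diamond degv degu v∼u v∼x (x≢u ∘ sym)
  ... | y , _ , D = begin
    6                                   ≡⟨ sym (cong₂ (λ a b → a + (b + 0)) (weight v∼x D.5≤degx) (weight D.v∼y 5≤degy)) ⟩
    ∑ (x ∷ y ∷ []) (charge v)           ≤⟨ ∑-Unique-⊆ ((∼⇒≢ D.x∼y ∷ []) ∷ [] ∷ []) (λ {z} _ → ∈-allFin z) (charge v) ⟩
    received v                          ∎
    where
    open ≤-Reasoning
    module D = Diamond D
    -- The diamond is built a second time with `y` in the place of `x`.
    5≤degy : 5 ≤ deg y
    5≤degy = Diamond.5≤degx (proj₂ (proj₂ (diamond degv degu v∼u D.v∼y (∼⇒≢ D.u∼y))))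
    weight : ∀ {z} → v ∼ z → 5 ≤ deg z → charge v z ≡ 3
    weight v∼z 5≤degz = trans (charge-light (degv , v∼z , 5≤degz)) (cong (2 +_) (⟦⟧-yes (special? v) special))

  6≤received-¬special : ∀ {v} → deg v ≡ 3 → ¬ Special v → 6 ≤ received v
  6≤received-¬special {v} degv ¬special
    with further-neighbour v [] (≤-trans (m≤m+n 1 2) (≤-reflexive (sym degv)))
  ... | x , v∼x , _ with deg₃ degv v∼x
  ... | y , z , D = begin
    6                                   ≡⟨ sym (cong₂ _+_ (weight v∼x) (cong₂ (λ a b → a + (b + 0)) (weight D.v∼y) (weight D.v∼z))) ⟩
    ∑ (x ∷ y ∷ z ∷ []) (charge v)       ≤⟨ ∑-Unique-⊆ ((∼⇒≢ D.x∼y ∷ ∼⇒≢ D.x∼z ∷ []) ∷ (∼⇒≢ D.y∼z ∷ []) ∷ [] ∷ [])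
                                             (λ {z} _ → ∈-allFin z) (charge v) ⟩
    received v                          ∎
    where
    open ≤-Reasoning
    module D = Deg₃ D
    weight : ∀ {z} → v ∼ z → charge v z ≡ 2
    weight {z} v∼z = trans
      (charge-light (degv , v∼z , heavy-neighbour degv v∼z λ degz → ¬special (z , v∼z , degz)))
      (cong (2 +_) (⟦⟧-no (special? v) ¬special))

  6≤received : ∀ {v} → deg v ≡ 3 → 6 ≤ received v
  6≤received {v} degv = [ 6≤received-special degv , 6≤received-¬special degv ]′ (toSum (special? v))

  -- Six times the final charge, `6 (deg x − 4) − sent x + received x`, is nonnegative, and at least
  -- 1 for degree 5 or more; the terms are moved so that nothing is subtracted.
  Balanced : Fin n → Set
  Balanced x = 24 + (sent x + ⟦ 5 ≤?ℕ deg x ⟧) ≤ 6 * deg x + received x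

  balanced-light : ∀ x → ¬ 5 ≤ deg x → 24 ≤ 6 * deg x + received x → Balanced x
  balanced-light x light le =
    subst (_≤ 6 * deg x + received x)
      (sym (cong (24 +_) (cong₂ _+_ (∑-zero λ v → charge-¬light (light ∘ proj₂ ∘ proj₂)) (⟦⟧-no (5 ≤?ℕ deg x) light)))) le

  balanced-heavy : ∀ x → 25 + sent x ≤ 6 * deg x → Balanced x
  balanced-heavy x le = begin
    24 + (sent x + ⟦ 5 ≤?ℕ deg x ⟧)   ≤⟨ +-monoʳ-≤ 24 (+-monoʳ-≤ (sent x) (⟦⟧≤1 (5 ≤?ℕ deg x))) ⟩
    24 + (sent x + 1)                 ≡⟨ cong (24 +_) (+-comm (sent x) 1) ⟩
    25 + sent x                       ≤⟨ le ⟩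
    6 * deg x                         ≤⟨ m≤m+n _ _ ⟩
    6 * deg x + received x            ∎
    where open ≤-Reasoning

  -- For `d = 5` the counting bound alone allows `t = 2`, and 25 + 6 exceeds 30; hence the separate
  -- hypothesis. From `d = 6` on, half of `6 * d` is at least 18 and the other half at least
  -- `9 + 3 * t`.
  bound₃ : ∀ d t → 5 ≤ d → 3 + t ≤ d → (d ≡ 5 → t ≤ 1) → 25 + 3 * t ≤ 6 * d
  bound₃ d t 5≤d 3+t≤d t≤1 with d ≟ℕ 5
  ... | yes refl = ≤-trans (+-monoʳ-≤ 25 (*-monoʳ-≤ 3 (t≤1 refl))) (m≤m+n 28 2)
  ... | no d≢5 = begin
    25 + 3 * t        ≤⟨ +-monoˡ-≤ (3 * t) (m≤m+n 25 2) ⟩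
    27 + 3 * t        ≡⟨ cong (18 +_) (sym (*-distribˡ-+ 3 3 t)) ⟩
    18 + 3 * (3 + t)  ≤⟨ +-mono-≤ (*-monoʳ-≤ 3 (≤∧≢⇒< 5≤d (d≢5 ∘ sym))) (*-monoʳ-≤ 3 3+t≤d) ⟩
    3 * d + 3 * d     ≡⟨ sym (*-distribʳ-+ d 3 3) ⟩
    6 * d             ∎
    where open ≤-Reasoning

  -- Again `d = 5` is critical: the counting bound allows `t = 3`, which gives 31. From `d = 6` on,
  -- `4 * d` is at least 24 and `2 * d` at least `4 + 2 * t`.
  bound₂ : ∀ d t → 5 ≤ d → 2 + t ≤ d → (d ≡ 5 → t ≤ 2) → 25 + 2 * t ≤ 6 * d
  bound₂ d t 5≤d 2+t≤d t≤2 with d ≟ℕ 5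
  ... | yes refl = ≤-trans (+-monoʳ-≤ 25 (*-monoʳ-≤ 2 (t≤2 refl))) (m≤m+n 29 1)
  ... | no d≢5 = begin
    25 + 2 * t        ≤⟨ +-monoˡ-≤ (2 * t) (m≤m+n 25 3) ⟩
    28 + 2 * t        ≡⟨ cong (24 +_) (sym (*-distribˡ-+ 2 2 t)) ⟩
    24 + 2 * (2 + t)  ≤⟨ +-mono-≤ (*-monoʳ-≤ 4 (≤∧≢⇒< 5≤d (d≢5 ∘ sym))) (*-monoʳ-≤ 2 2+t≤d) ⟩
    4 * d + 2 * d     ≡⟨ sym (*-distribʳ-+ d 4 2) ⟩
    6 * d             ∎
    where open ≤-Reasoning

  -- A single special neighbour of degree 3 already yields a diamond at `x`, which limits `N₃ x`
  -- enough to charge 3 for each of its members. Without one, each costs only 2 and the weaker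
  -- bounds suffice.
  heavy : ∀ x → 5 ≤ deg x → 25 + sent x ≤ 6 * deg x
  heavy x 5≤degx with any? (λ v → light? v x ×-dec special? v)
  ... | yes (v , (degv , v∼x , _) , u , v∼u , degu) with u Finₚ.≟ x
  ...   | yes refl = contradiction (subst (5 ≤_) degu 5≤degx) (λ { (s≤s (s≤s (s≤s (s≤s ())))) })
  ...   | no u≢x with diamond degv degu v∼u v∼x u≢x
  ...     | y , u′ , D = ≤-trans (+-monoʳ-≤ 25 (sent≤ x 3 λ {v} _ → +-monoʳ-≤ 2 (⟦⟧≤1 (special? v))))
            (bound₃ (deg x) _ 5≤degx (diamond-N₃ degv degu D) (diamond-N₃-5 degv degu D))
  heavy x 5≤degx | no none with any? (λ v → light? v x)
  ... | yes (v , degv , v∼x , _) = ≤-trans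
        (+-monoʳ-≤ 25 (sent≤ x 2 λ {v} light → ≤-reflexive (cong (2 +_) (⟦⟧-no (special? v) λ sp → none (v , light , sp)))))
        (bound₂ (deg x) _ 5≤degx (N₃-bound-2 degv v∼x) (N₃-bound-5 degv v∼x))
  ... | no ¬light = ≤-trans
        (+-monoʳ-≤ 25 (≤-reflexive (∑-zero λ v → charge-¬light λ light → ¬light (v , light))))
        (≤-trans (m≤m+n 25 5) (*-monoʳ-≤ 6 5≤degx))

  balanced : ∀ x → Balanced x
  balanced x with 5 ≤?ℕ deg x
  ... | yes 5≤degx = balanced-heavy x (heavy x 5≤degx)
  ... | no light with deg x ≟ℕ 3
  ...   | yes degx = balanced-light x light
          (subst (λ d → 24 ≤ 6 * d + received x) (sym degx) (+-monoʳ-≤ 18 (6≤received degx)))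
  ...   | no degx≢3 = balanced-light x light
          (≤-trans (*-monoʳ-≤ 6 (≤∧≢⇒< (3≤deg x) (degx≢3 ∘ sym))) (m≤m+n _ _))

  -- In the sum of `Balanced` over all vertices the charges sent and received cancel by exchanging
  -- the sums, and six times the degree sum is at most `24 * n`. Only the count of vertices of
  -- degree at least 5 remains.
  heavy-count : ∑ (allFin n) (λ x → ⟦ 5 ≤?ℕ deg x ⟧) ≤ 0
  heavy-count = +-cancelˡ-≤ (24 * n + ∑ V sent) _ _ (begin
    24 * n + ∑ V sent + ∑ V h                ≡⟨ +-assoc (24 * n) (∑ V sent) (∑ V h) ⟩
    24 * n + (∑ V sent + ∑ V h)              ≡⟨ cong₂ _+_ (trans (*-comm 24 n) (sym (trans (∑-const V 24) (cong (_* 24) (length-tabulate {n = n} id))))) (sym (∑-+ V sent h)) ⟩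
    ∑ V (λ _ → 24) + ∑ V (λ x → sent x + h x) ≡⟨ sym (∑-+ V (λ _ → 24) (λ x → sent x + h x)) ⟩
    ∑ V (λ x → 24 + (sent x + h x))          ≤⟨ ∑-mono V balanced ⟩
    ∑ V (λ x → 6 * deg x + received x)       ≡⟨ trans (∑-+ V (λ x → 6 * deg x) received) (cong (_+ ∑ V received) (∑-*ˡ V 6 deg)) ⟩
    6 * ∑ V deg + ∑ V received               ≤⟨ +-monoˡ-≤ (∑ V received) (*-monoʳ-≤ 6 (≤-trans handshake (*-monoʳ-≤ 2 size≤2n))) ⟩
    6 * (2 * (2 * n)) + ∑ V received         ≡⟨ cong₂ _+_ (trans (cong (6 *_) (sym (*-assoc 2 2 n))) (sym (*-assoc 6 4 n))) (∑-swap V V charge) ⟩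
    24 * n + ∑ V sent                        ≡⟨ sym (+-identityʳ _) ⟩
    24 * n + ∑ V sent + 0                    ∎)
    where
    open ≤-Reasoning
    V = allFin n
    h : Fin n → ℕ
    h x = ⟦ 5 ≤?ℕ deg x ⟧

  deg≤4 : ∀ x → ¬ 5 ≤ deg x
  deg≤4 x 5≤degx = contradiction (begin
    1                                             ≡⟨ sym (⟦⟧-yes (5 ≤?ℕ deg x) 5≤degx) ⟩
    ⟦ 5 ≤?ℕ deg x ⟧                               ≡⟨ sym (+-identityʳ _) ⟩
    ∑ (x ∷ []) (λ x → ⟦ 5 ≤?ℕ deg x ⟧)            ≤⟨ ∑-Unique-⊆ {xs = x ∷ []} ([] ∷ []) (λ {z} _ → ∈-allFin z) (λ x → ⟦ 5 ≤?ℕ deg x ⟧) ⟩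
    ∑ (allFin n) (λ x → ⟦ 5 ≤?ℕ deg x ⟧)          ≤⟨ heavy-count ⟩
    0                                             ∎) λ ()
    where open ≤-Reasoning

  -- Without vertices of degree at least 5 nothing is sent, whereas a vertex of degree 3 receives at
  -- least 6.
  4-regular : ∀ x → deg x ≡ 4
  4-regular x = ≤-antisym (≮⇒≥ (deg≤4 x)) (≤∧≢⇒< (3≤deg x) λ 3≡degx →
    contradiction (subst (6 ≤_) (∑-zero λ u → charge-¬light (deg≤4 u ∘ proj₂ ∘ proj₂)) (6≤received (sym 3≡degx))) λ ())

-- The 4-regular case

module Regular {n : ℕ} (G : Graph (Fin n)) (7≤n : 7 ≤ n)
  (¬separated₂ : Separation.NoSeparatingPair G) (triangle : Separation.TriangularCuts G)
  (4-regular : ∀ x → Degree.deg G x ≡ 4)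
  where
  open Triangular G 7≤n ¬separated₂ triangle

  -- Otherwise x could be dropped from the cut.
  neighbour-in-I : ∀ {L} (s : Split (_∈ L)) x M → M ⊆ L → L ⊆ x ∷ M → length M ≤ 2 → ∃[ p ] Split.I s p × x ∼ p
  neighbour-in-I {L} s x M M⊆L L⊆xM M≤2 with any? (λ p → Split.I? s p ×-dec (x ∼? p))
  ... | yes found = found
  ... | no none = contradiction
    (separate I? Iu (I∩P Iu ∘ M⊆L) (λ Iw → I∩O Iw Ow) (O∩P Ow ∘ M⊆L) cross) (¬separated₂ M M≤2)
    where
    open Split s
    cross : ∀ {p q} → I p → p ∉ M → ¬ I q → q ∉ M → ¬ p ∼ q
    cross {p} {q} Ip _ ¬Iq q∉M p∼q with q ∈? L
    ... | no q∉L = [ ¬Iq , (λ Oq → no-crossing Ip Oq p∼q) ]′ (I∪O q∉L)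
    ... | yes q∈L with L⊆xM q∈L
    ...   | here refl = none (p , Ip , ∼-sym p∼q)
    ...   | there q∈M = q∉M q∈M

  -- Two neighbours of `a` lie in the triangle, so degree 4 leaves exactly one on each side.
  -- Replacing `a` by its inner neighbour `a₁` gives another separating triple, again a triangle,
  -- hence `a₁ ∼ b`. But `b` needs an inner neighbour for the new cut as well, and this is its fifth
  -- neighbour.
  module TriangleCut {a b c a₁ a₂ b₂ : Fin n} (s : Split (_∈ a ∷ b ∷ c ∷ []))
    (a∼b : a ∼ b) (b∼c : b ∼ c) (a∼c : a ∼ c)
    (Ia₁ : Split.I s a₁) (a∼a₁ : a ∼ a₁) (Oa₂ : Split.O s a₂) (a∼a₂ : a ∼ a₂) (Ob₂ : Split.O s b₂) (b∼b₂ : b ∼ b₂)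
    where
    open Split s

    I≢ : ∀ {p q} → I p → q ∈ a ∷ b ∷ c ∷ [] → p ≢ q
    I≢ Ip q∈ refl = I∩P Ip q∈
    O≢ : ∀ {p q} → O p → q ∈ a ∷ b ∷ c ∷ [] → q ≢ p
    O≢ Op q∈ refl = O∩P Op q∈
    I≢O : ∀ {p q} → I p → O q → p ≢ q
    I≢O Ip Op refl = I∩O Ip Op
    a-covers : Cover a (b ∷ c ∷ a₁ ∷ a₂ ∷ [])
    a-covers = cover ((∼⇒≢ b∼c ∷ I≢ Ia₁ at1 ∘ sym ∷ O≢ Oa₂ at1 ∷ []) ∷ (I≢ Ia₁ at2 ∘ sym ∷ O≢ Oa₂ at2 ∷ []) ∷
      (I≢O Ia₁ Oa₂ ∷ []) ∷ [] ∷ []) (a∼b ∷ a∼c ∷ a∼a₁ ∷ a∼a₂ ∷ []) (≤-reflexive (4-regular a))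
    -- At most three neighbours of `a₁` lie in the cut, so a fourth one keeps the inner side
    -- inhabited once `a₁` has moved into the cut.
    second : ∃[ z ] a₁ ∼ z × All (z ≢_) (a ∷ b ∷ c ∷ [])
    second = further-neighbour a₁ (a ∷ b ∷ c ∷ []) (≤-reflexive (sym (4-regular a₁)))
    z = proj₁ second
    Iz : I z
    Iz = [ id , (λ Oz → contradiction (proj₁ (proj₂ second)) (no-crossing Ia₁ Oz)) ]′
      (I∪O λ z∈ → All.lookup (proj₂ (proj₂ second)) z∈ refl)
    -- As a₁ is the only neighbour of a in I, it can replace a in the cut.
    s′ : Split (_∈ a₁ ∷ b ∷ c ∷ [])
    s′ = record
      { I = λ p → I p × p ≢ a₁
      ; O = λ p → O p ⊎ p ≡ a
      ; I? = λ p → I? p ×-dec ¬? (p Finₚ.≟ a₁)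
      ; O? = λ p → O? p ⊎-dec (p Finₚ.≟ a)
      ; I∩P = λ { (_ , p≢a₁) (here refl) → p≢a₁ refl ; (Ip , _) (there p∈) → I∩P Ip (there p∈) }
      ; O∩P = λ { (inj₁ Op) (here refl) → I∩O Ia₁ Op ; (inj₁ Op) (there p∈) → O∩P Op (there p∈)
                ; (inj₂ refl) at0 → ∼⇒≢ a∼a₁ refl ; (inj₂ refl) at1 → ∼⇒≢ a∼b refl ; (inj₂ refl) at2 → ∼⇒≢ a∼c refl }
      ; I∩O = λ { (Ip , _) (inj₁ Op) → I∩O Ip Op ; (Ip , _) (inj₂ refl) → I∩P Ip (here refl) }
      ; I∪O = cases
      ; no-crossing = λ { (Ip , _) (inj₁ Oq) → no-crossing Ip Oq ; (Ip , p≢a₁) (inj₂ refl) p∼a → isolated Ip p≢a₁ (a-covers (∼-sym p∼a)) }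
      ; Iu = Iz , ∼⇒≢ (proj₁ (proj₂ second)) ∘ sym ; Ow = inj₁ Ow }
      where
      isolated : ∀ {p} → I p → p ≢ a₁ → p ∉ b ∷ c ∷ a₁ ∷ a₂ ∷ []
      isolated Ip _ at0 = I∩P Ip at1
      isolated Ip _ at1 = I∩P Ip at2
      isolated _ p≢a₁ at2 = p≢a₁ refl
      isolated Ip _ at3 = I∩O Ip Oa₂
      cases : ∀ {p} → p ∉ a₁ ∷ b ∷ c ∷ [] → (I p × p ≢ a₁) ⊎ (O p ⊎ p ≡ a)
      cases {p} p∉ with p Finₚ.≟ a
      ... | yes p≡a = inj₂ (inj₂ p≡a)
      ... | no p≢a = [ (λ Ip → inj₁ (Ip , λ p≡a₁ → p∉ (here p≡a₁))) , (λ Op → inj₂ (inj₁ Op)) ]′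
            (I∪O λ { (here p≡a) → p≢a p≡a ; (there p∈) → p∉ (there p∈) })
    a₁∼b : a₁ ∼ b
    a₁∼b = proj₁ (triangle (Split⇒Separated s′))
    third : ∃[ p ] Split.I s′ p × b ∼ p
    third = neighbour-in-I s′ b (a₁ ∷ c ∷ []) (λ { at0 → at0 ; at1 → at2 }) (λ { at0 → at1 ; at1 → at0 ; at2 → at2 }) ≤-refl
    p = proj₁ third
    Ip = proj₁ (proj₁ (proj₂ third))
    unique : Unique (p ∷ a₁ ∷ a ∷ c ∷ b₂ ∷ [])
    unique = (proj₂ (proj₁ (proj₂ third)) ∷ I≢ Ip at0 ∷ I≢ Ip at2 ∷ I≢O Ip Ob₂ ∷ []) ∷
      (I≢ Ia₁ at0 ∷ I≢ Ia₁ at2 ∷ I≢O Ia₁ Ob₂ ∷ []) ∷ (∼⇒≢ a∼c ∷ O≢ Ob₂ at0 ∷ []) ∷ (O≢ Ob₂ at2 ∷ []) ∷ [] ∷ []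
    adjacent : All (b ∼_) (p ∷ a₁ ∷ a ∷ c ∷ b₂ ∷ [])
    adjacent = proj₂ (proj₂ third) ∷ ∼-sym a₁∼b ∷ ∼-sym a∼b ∷ b∼c ∷ b∼b₂ ∷ []

    five-neighbours : ⊥
    five-neighbours =
      contradiction (≤-trans (length≤deg unique adjacent) (≤-reflexive (4-regular b))) λ { (s≤s (s≤s (s≤s (s≤s ())))) }

  ¬separated₃ : ∀ {a b c} → ¬ Separated (_∈ a ∷ b ∷ c ∷ [])
  ¬separated₃ {a} {b} {c} sep with triangle sep | Separated⇒Split (_∈? (a ∷ b ∷ c ∷ [])) sep
  ... | a∼b , b∼c , a∼c | s
    with neighbour-in-I s a (b ∷ c ∷ []) there id ≤-refl | neighbour-in-I (swap s) a (b ∷ c ∷ []) there id ≤-refl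
       | neighbour-in-I (swap s) b (a ∷ c ∷ []) (λ { at0 → at0 ; at1 → at2 }) (λ { at0 → at1 ; at1 → at0 ; at2 → at2 }) ≤-refl
  ... | _ , Ia₁ , a∼a₁ | _ , Oa₂ , a∼a₂ | _ , Ob₂ , b∼b₂ =
    TriangleCut.five-neighbours s a∼b b∼c a∼c Ia₁ a∼a₁ Oa₂ a∼a₂ Ob₂ b∼b₂

  ¬separated≤3 : ∀ L → length L ≤ 3 → ¬ Separated (_∈ L)
  ¬separated≤3 [] _ = ¬separated₂ _ z≤n
  ¬separated≤3 (_ ∷ []) _ = ¬separated₂ _ (m≤m+n 1 1)
  ¬separated≤3 (_ ∷ _ ∷ []) _ = ¬separated₂ _ ≤-refl
  ¬separated≤3 (_ ∷ _ ∷ _ ∷ []) _ = ¬separated₃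
  ¬separated≤3 (_ ∷ _ ∷ _ ∷ _ ∷ _) (s≤s (s≤s (s≤s ())))

  minimum₄ : Minimum 4
  minimum₄ S sep = ≰⇒> λ S≤3 → ¬separated≤3 (elements S) (subst (_≤ 3) (sym (length-elements S)) S≤3)
    (Separated-cong ∈-elements⁺ ∈-elements⁻ sep)

  foresty₄ : ∀ L → length L ≤ 4 → Separated (_∈ L) → Forest (induced G (fromList L)) → HasForestyMinimumVertexCut G
  foresty₄ L L≤4 sep = forestyMinimumVertexCut 7≤n (fromList L)
    (Separated-cong (∈⟪⟫⁺ (_∈? L)) (∈⟪⟫⁻ (_∈? L)) sep) (≤-trans S≤4 (m≤m+n 4 2)) (λ S′ sep′ → ≤-trans S≤4 (minimum₄ S′ sep′))
    where
    S≤4 : ∣ fromList L ∣ ≤ 4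
    S≤4 = ≤-trans (∣fromList∣≤length L) L≤4

  -- The only possible edges are `p q` and `r s`, so each vertex has at most one neighbour in the
  -- set, whereas the start of a cycle has two: its second and its last vertex.
  matching-forest : ∀ {p q r s} → ¬ p ∼ r → ¬ p ∼ s → ¬ q ∼ r → ¬ q ∼ s → Forest (induced G (fromList (p ∷ q ∷ r ∷ s ∷ [])))
  matching-forest {p} {q} {r} {s} p≁r p≁s q≁r q≁s cyc =
    contradiction (point-injective cyc {suc zero} {fromℕ (2 + k)}
      (unique-neighbour (∈L zero) (∈L (suc zero)) (∈L (fromℕ (2 + k))) (steps zero) (∼-sym closing))) λ ()
    where
    open Cycle cyc
    L = p ∷ q ∷ r ∷ s ∷ []
    ∈L : ∀ i → point cyc i ∈ L
    ∈L i = ∈⟪⟫⁻ (_∈? L) (point∈ cyc i)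
    partner : ∀ {x} → x ∈ L → ∃[ t ] ∀ {y} → y ∈ L → x ∼ y → y ≡ t
    partner at0 = q , λ { at0 e → contradiction refl (∼⇒≢ e) ; at1 e → refl
                        ; at2 e → contradiction e p≁r ; at3 e → contradiction e p≁s }
    partner at1 = p , λ { at0 e → refl ; at1 e → contradiction refl (∼⇒≢ e)
                        ; at2 e → contradiction e q≁r ; at3 e → contradiction e q≁s }
    partner at2 = s , λ { at0 e → contradiction (∼-sym e) p≁r ; at1 e → contradiction (∼-sym e) q≁r
                        ; at2 e → contradiction refl (∼⇒≢ e) ; at3 e → refl }
    partner at3 = r , λ { at0 e → contradiction (∼-sym e) p≁s ; at1 e → contradiction (∼-sym e) q≁s
                        ; at2 e → refl ; at3 e → contradiction refl (∼⇒≢ e) }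
    unique-neighbour : ∀ {x y z} → x ∈ L → y ∈ L → z ∈ L → x ∼ y → x ∼ z → y ≡ z
    unique-neighbour x∈ y∈ z∈ x∼y x∼z with partner x∈
    ... | _ , only = trans (only y∈ x∼y) (sym (only z∈ x∼z))

  record K₄ (a b c d : Fin n) : Set where
    constructor mkK₄
    field
      a∼b : a ∼ b
      a∼c : a ∼ c
      a∼d : a ∼ d
      b∼c : b ∼ c
      b∼d : b ∼ d
      c∼d : c ∼ d

  outer : ∀ {x p q r} → x ∼ p → x ∼ q → x ∼ r → p ∼ q → p ∼ r → q ∼ r →
          ∃[ x′ ] x ∼ x′ × All (x′ ≢_) (p ∷ q ∷ r ∷ []) × Cover x (x′ ∷ p ∷ q ∷ r ∷ [])
  outer {x} {p} {q} {r} x∼p x∼q x∼r p∼q p∼r q∼r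
    with further-neighbour x (p ∷ q ∷ r ∷ []) (≤-reflexive (sym (4-regular x)))
  ... | x′ , x∼x′ , x′≢ = x′ , x∼x′ , x′≢ ,
    cover (x′≢ ∷ (∼⇒≢ p∼q ∷ ∼⇒≢ p∼r ∷ []) ∷ (∼⇒≢ q∼r ∷ []) ∷ [] ∷ []) (x∼x′ ∷ x∼p ∷ x∼q ∷ x∼r ∷ []) (≤-reflexive (4-regular x))

  -- If `x` and `y` shared their outer neighbour, it would together with `p` and `q` cut off `x` and
  -- `y`.
  outer-distinct : ∀ {x y p q x′ y′} → x ∼ p → x ∼ q → x ∼ x′ →
                   Cover x (x′ ∷ y ∷ p ∷ q ∷ []) → Cover y (y′ ∷ x ∷ p ∷ q ∷ []) → x′ ≢ y′
  outer-distinct {x} {y} {p} {q} {x′} x∼p x∼q x∼x′ x-covers y-covers refl = ¬separated₃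
    (cut x (y ∷ []) (p ∷ q ∷ x′ ∷ []) (∼⇒≢ x∼p ∷ ∼⇒≢ x∼q ∷ ∼⇒≢ x∼x′ ∷ []) (m≤m+n 5 1)
      ((x-covers ▸ at4 ∷ at1 ∷ at2 ∷ at3 ∷ []) ∷ (y-covers ▸ at4 ∷ at0 ∷ at2 ∷ at3 ∷ []) ∷ []))

  -- With c′, d′ the neighbours of c, d outside the clique, {a, b, c′, d′} cuts off
  -- {c, d} and has no edges besides a b and c′ d′.
  K₄⇒foresty : ∀ {a b c d} → K₄ a b c d → HasForestyMinimumVertexCut G
  K₄⇒foresty {a} {b} {c} {d} (mkK₄ a∼b a∼c a∼d b∼c b∼d c∼d)
    with outer a∼b a∼c a∼d b∼c b∼d c∼d | outer (∼-sym a∼b) b∼c b∼d a∼c a∼d c∼d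
       | outer (∼-sym a∼c) (∼-sym b∼c) c∼d a∼b a∼d b∼d | outer (∼-sym a∼d) (∼-sym b∼d) (∼-sym c∼d) a∼b a∼c b∼c
  ... | a′ , a∼a′ , _ , a-covers | b′ , b∼b′ , _ , b-covers
      | c′ , c∼c′ , c′≢a ∷ c′≢b ∷ c′≢d ∷ [] , c-covers | d′ , d∼d′ , d′≢a ∷ d′≢b ∷ d′≢c ∷ [] , d-covers =
    foresty₄ (a ∷ b ∷ c′ ∷ d′ ∷ []) ≤-refl
      (cut c (d ∷ []) (a ∷ b ∷ c′ ∷ d′ ∷ []) (∼⇒≢ a∼c ∘ sym ∷ ∼⇒≢ b∼c ∘ sym ∷ ∼⇒≢ c∼c′ ∷ d′≢c ∘ sym ∷ []) ≤-refl
        ((c-covers ▸ at4 ∷ at2 ∷ at3 ∷ at1 ∷ []) ∷ (d-covers ▸ at5 ∷ at2 ∷ at3 ∷ at0 ∷ []) ∷ []))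
      (matching-forest
        (λ a∼c′ → apart (a-covers a∼c′) a′≢c′ c′≢b (∼⇒≢ c∼c′ ∘ sym) c′≢d)
        (λ a∼d′ → apart (a-covers a∼d′) a′≢d′ d′≢b d′≢c (∼⇒≢ d∼d′ ∘ sym))
        (λ b∼c′ → apart (b-covers b∼c′) b′≢c′ c′≢a (∼⇒≢ c∼c′ ∘ sym) c′≢d)
        (λ b∼d′ → apart (b-covers b∼d′) b′≢d′ d′≢a d′≢c (∼⇒≢ d∼d′ ∘ sym)))
    where
    apart : ∀ {x x₁ x₂ x₃ x₄ : Fin n} → x ∈ x₁ ∷ x₂ ∷ x₃ ∷ x₄ ∷ [] → x₁ ≢ x → x ≢ x₂ → x ≢ x₃ → x ≢ x₄ → ⊥
    apart at0 ne _ _ _ = ne refl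
    apart at1 _ ne _ _ = ne refl
    apart at2 _ _ ne _ = ne refl
    apart at3 _ _ _ ne = ne refl
    a′≢c′ : a′ ≢ c′
    a′≢c′ = outer-distinct a∼b a∼d a∼a′ (a-covers ▸ at0 ∷ at2 ∷ at1 ∷ at3 ∷ []) c-covers
    a′≢d′ : a′ ≢ d′
    a′≢d′ = outer-distinct a∼b a∼c a∼a′ (a-covers ▸ at0 ∷ at2 ∷ at3 ∷ at1 ∷ []) d-covers
    b′≢c′ : b′ ≢ c′
    b′≢c′ = outer-distinct (∼-sym a∼b) b∼d b∼b′ (b-covers ▸ at0 ∷ at2 ∷ at1 ∷ at3 ∷ []) (c-covers ▸ at0 ∷ at2 ∷ at1 ∷ at3 ∷ [])
    b′≢d′ : b′ ≢ d′
    b′≢d′ = outer-distinct (∼-sym a∼b) b∼c b∼b′ (b-covers ▸ at0 ∷ at2 ∷ at3 ∷ at1 ∷ []) (d-covers ▸ at0 ∷ at2 ∷ at1 ∷ at3 ∷ [])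

  -- A wheel with hub `v` and rim the 4-cycle `a b c d`. By regularity the rim is the entire
  -- neighbourhood of the hub.
  record Rim (v a b c d : Fin n) : Set where
    constructor mkRim
    field
      v∼a : v ∼ a
      v∼b : v ∼ b
      v∼c : v ∼ c
      v∼d : v ∼ d
      a≢c : a ≢ c
      b≢d : b ≢ d
      a∼b : a ∼ b
      b∼c : b ∼ c
      c∼d : c ∼ d
      d∼a : d ∼ a
    covers : Cover v (a ∷ b ∷ c ∷ d ∷ [])
    covers = cover ((∼⇒≢ a∼b ∷ a≢c ∷ ∼⇒≢ d∼a ∘ sym ∷ []) ∷ (∼⇒≢ b∼c ∷ b≢d ∷ []) ∷ (∼⇒≢ c∼d ∷ []) ∷ [] ∷ [])
      (v∼a ∷ v∼b ∷ v∼c ∷ v∼d ∷ []) (≤-reflexive (4-regular v))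

  rotate : ∀ {v a b c d} → Rim v a b c d → Rim v b c d a
  rotate (mkRim va vb vc vd a≢c b≢d ab bc cd da) = mkRim vb vc vd va b≢d (a≢c ∘ sym) bc cd da ab

  module _ (¬K₄ : ∀ {a b c d} → ¬ K₄ a b c d) where

    -- Two adjacent wheels force an octahedron, from which at most two vertices lead out.
    octahedron : ∀ {v a b c d f g h} → Rim v a b c d → ¬ Rim a v f g h
    octahedron {v} {a} {b} {c} {d} {f} {g} {h} R Q =
      ¬separated₂ (c ∷ g ∷ []) ≤-refl
        (cut v (a ∷ b ∷ d ∷ []) (c ∷ g ∷ []) (∼⇒≢ R.v∼c ∷ Q.a≢c ∷ []) ≤-refl
          ((R.covers ▸ at1 ∷ at2 ∷ at4 ∷ at3 ∷ []) ∷
           (cover ((∼⇒≢ R.v∼b ∷ Q.a≢c ∷ ∼⇒≢ R.v∼d ∷ []) ∷ (∼⇒≢ b∼g ∷ R.b≢d ∷ []) ∷ (∼⇒≢ d∼g ∘ sym ∷ []) ∷ [] ∷ [])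
              (∼-sym R.v∼a ∷ R.a∼b ∷ Q.v∼c ∷ ∼-sym R.d∼a ∷ []) (≤-reflexive (4-regular a)) ▸ at0 ∷ at2 ∷ at5 ∷ at3 ∷ []) ∷
           opposite (∼-sym R.v∼b) (∼-sym R.a∼b) R.b∼c b∼g ∷
           opposite (∼-sym R.v∼d) R.d∼a (∼-sym R.c∼d) d∼g ∷ []))
      where
      module R = Rim R
      module Q = Rim Q
      a≁c : ¬ a ∼ c
      a≁c a∼c = ¬K₄ (mkK₄ R.v∼a R.v∼b R.v∼c R.a∼b a∼c R.b∼c)
      common : ∀ {x} → v ∼ x → a ∼ x → x ≡ b ⊎ x ≡ d
      common v∼x a∼x with R.covers v∼x
      ... | at0 = contradiction refl (∼⇒≢ a∼x)
      ... | at1 = inj₁ refl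
      ... | at2 = contradiction a∼x a≁c
      ... | at3 = inj₂ refl
      -- Both `f` and `h` are common neighbours of `v` and `a`, so they are `b` and `d` in some
      -- order, and the rim joins `g` to both.
      bd∼g : b ∼ g × d ∼ g
      bd∼g with common Q.a∼b Q.v∼b | common (∼-sym Q.d∼a) Q.v∼d
      ... | inj₁ refl | inj₁ refl = contradiction refl Q.b≢d
      ... | inj₁ refl | inj₂ refl = Q.b∼c , ∼-sym Q.c∼d
      ... | inj₂ refl | inj₁ refl = ∼-sym Q.c∼d , Q.b∼c
      ... | inj₂ refl | inj₂ refl = contradiction refl Q.b≢d
      b∼g = proj₁ bd∼g
      d∼g = proj₂ bd∼g
      c≢g : c ≢ g
      c≢g refl = a≁c Q.v∼c
      opposite : ∀ {x} → x ∼ v → x ∼ a → x ∼ c → x ∼ g → Cover x (v ∷ a ∷ b ∷ d ∷ c ∷ g ∷ [])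
      opposite {x} x∼v x∼a x∼c x∼g =
        cover ((∼⇒≢ R.v∼a ∷ ∼⇒≢ R.v∼c ∷ Q.a≢c ∷ []) ∷ (R.a≢c ∷ ∼⇒≢ Q.v∼c ∷ []) ∷ (c≢g ∷ []) ∷ [] ∷ [])
          (x∼v ∷ x∼a ∷ x∼c ∷ x∼g ∷ []) (≤-reflexive (4-regular x)) ▸ at0 ∷ at1 ∷ at4 ∷ at5 ∷ []

    -- As a neighbour of `a`, the hub `v` lies on the rim around `a`; rotation brings it to the
    -- first place.
    adjacent-rims : ∀ {v a b c d e f g h} → Rim v a b c d → ¬ Rim a e f g h
    adjacent-rims R Q with Rim.covers Q (∼-sym (Rim.v∼a R))
    ... | at0 = octahedron R Q
    ... | at1 = octahedron R (rotate Q)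
    ... | at2 = octahedron R (rotate (rotate Q))
    ... | at3 = octahedron R (rotate (rotate (rotate Q)))

    -- In the four-vertex cut `N v`, a triangle would form a `K₄` with `v`, a 4-cycle would be a
    -- rim, and a longer cycle does not fit.
    ¬Rim⇒foresty : ∀ v → (∀ {a b c d} → ¬ Rim v a b c d) → HasForestyMinimumVertexCut G
    ¬Rim⇒foresty v ¬rim = foresty₄ (N v) (≤-reflexive (4-regular v))
      (cut v [] (N v) (All.tabulate (∼⇒≢ ∘ ∈N⁻)) (≤-trans (s≤s (≤-reflexive (4-regular v))) (m≤m+n 5 1)) ((there ∘ ∈N⁺) ∷ []))
      forest
      where
      module _ (cyc : Cycle (induced G (fromList (N v)))) where
        v∼ : ∀ i → v ∼ point cyc i
        v∼ i = ∈N⁻ (∈⟪⟫⁻ (_∈? N v) (point∈ cyc i))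
      forest : Forest (induced G (fromList (N v)))
      forest cyc@record { k = 0 ; steps = steps ; closing = closing } =
        ¬K₄ (mkK₄ (v∼ cyc zero) (v∼ cyc (suc zero)) (v∼ cyc (suc (suc zero))) (steps zero) (∼-sym closing) (steps (suc zero)))
      forest cyc@record { k = 1 ; steps = steps ; closing = closing } =
        ¬rim (mkRim (v∼ cyc zero) (v∼ cyc (suc zero)) (v∼ cyc (suc (suc zero))) (v∼ cyc (suc (suc (suc zero))))
          (λ eq → contradiction (point-injective cyc eq) λ ()) (λ eq → contradiction (point-injective cyc eq) λ ())
          (steps zero) (steps (suc zero)) (steps (suc (suc zero))) closing)
      forest cyc@record { k = suc (suc k) } =
        contradiction (≤-trans (cycle-length cyc (∈⟪⟫⁻ (_∈? N v))) (≤-reflexive (4-regular v)))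
          λ { (s≤s (s≤s (s≤s (s≤s ())))) }

  K₄? : ∀ a b c d → Dec (K₄ a b c d)
  K₄? a b c d = map′ (λ (ab , ac , ad , bc , bd , cd) → mkK₄ ab ac ad bc bd cd)
    (λ (mkK₄ ab ac ad bc bd cd) → ab , ac , ad , bc , bd , cd)
    ((a ∼? b) ×-dec (a ∼? c) ×-dec (a ∼? d) ×-dec (b ∼? c) ×-dec (b ∼? d) ×-dec (c ∼? d))

  Rim? : ∀ v a b c d → Dec (Rim v a b c d)
  Rim? v a b c d = map′ (λ (va , vb , vc , vd , a≢c , b≢d , ab , bc , cd , da) → mkRim va vb vc vd a≢c b≢d ab bc cd da)
    (λ (mkRim va vb vc vd a≢c b≢d ab bc cd da) → va , vb , vc , vd , a≢c , b≢d , ab , bc , cd , da)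
    ((v ∼? a) ×-dec (v ∼? b) ×-dec (v ∼? c) ×-dec (v ∼? d) ×-dec ¬? (a Finₚ.≟ c) ×-dec ¬? (b Finₚ.≟ d) ×-dec
     (a ∼? b) ×-dec (b ∼? c) ×-dec (c ∼? d) ×-dec (d ∼? a))

  rim? : ∀ v → Dec (∃[ a ] ∃[ b ] ∃[ c ] ∃[ d ] Rim v a b c d)
  rim? v = any? λ a → any? λ b → any? λ c → any? λ d → Rim? v a b c d

  -- Without a `K₄`, start from any vertex: if its neighbourhood carries a rim, then the
  -- neighbourhood of a rim vertex does not.
  foresty : HasForestyMinimumVertexCut G
  foresty with any? (λ a → any? λ b → any? λ c → any? λ d → K₄? a b c d)
  ... | yes (_ , _ , _ , _ , K) = K₄⇒foresty K
  ... | no noK with rim? v₀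
    where v₀ = fromℕ< (≤-trans (m≤m+n 1 6) 7≤n)
  ...   | no ¬rim = ¬Rim⇒foresty (λ K → noK (_ , _ , _ , _ , K)) _ (λ R → ¬rim (_ , _ , _ , _ , R))
  ...   | yes (a , _ , _ , _ , R) = ¬Rim⇒foresty (λ K → noK (_ , _ , _ , _ , K)) a
            (adjacent-rims (λ K → noK (_ , _ , _ , _ , K)) R)

-- The upper bound assembled

small-size⇒foresty : ∀ {n} (G : Graph (Fin n)) → 7 ≤ n → size G ≤ 2 * n → HasForestyMinimumVertexCut G
small-size⇒foresty {n} G 7≤n size≤2n
  with Subsetₚ.anySubset? (λ S → separated? (Subsetₚ._∈? S) ×-dec (∣ S ∣ ≤?ℕ 2))
  where open Separation G
... | yes (S , sep , S≤2) =
  let open Separation G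
      (S′ , sep′ , S′≤2 , min) = minimum-separator 2 S sep S≤2
  in forestyMinimumVertexCut 7≤n S′ sep′ (≤-trans S′≤2 (m≤m+n 2 4)) min (∣S∣≤2⇒Forest S′ S′≤2)
... | no none₂
  with Subsetₚ.anySubset? (λ S → Separation.separated? G (Subsetₚ._∈? S) ×-dec (∣ S ∣ ≟ℕ 3) ×-dec ¬? (Separation.clique? G S))
... | yes (S , sep , S≡3 , ¬clique) =
  forestyMinimumVertexCut 7≤n S sep (≤-trans (≤-reflexive S≡3) (m≤m+n 3 3))
    (λ S′ sep′ → subst (_≤ ∣ S′ ∣) (sym S≡3) (≰⇒> λ S′≤2 → none₂ (S′ , sep′ , S′≤2)))
    (¬Clique⇒Forest S S≡3 ¬clique)
  where open Separation G
... | no none₃ = Regular.foresty G 7≤n ¬separated₂ triangle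
      (Discharging.4-regular G 7≤n ¬separated₂ triangle size≤2n)
  where
  open Separation G
  asSubset : ∀ {L} → Separated (_∈ L) → Separated (_∈ˢ fromList L)
  asSubset {L} = Separated-cong (∈⟪⟫⁺ (_∈? L)) (∈⟪⟫⁻ (_∈? L))
  ¬separated₂ : ∀ L → length L ≤ 2 → ¬ Separated (_∈ L)
  ¬separated₂ L L≤2 sep = none₂ (fromList L , asSubset sep , ≤-trans (∣fromList∣≤length L) L≤2)
  module _ {a b c : Fin n} (sep : Separated (_∈ a ∷ b ∷ c ∷ [])) where
    L = a ∷ b ∷ c ∷ []
    -- A repeated entry would leave a separating pair; this gives the distinctness on which
    -- adjacency in a clique depends.
    shrink : ∀ x y → L ⊆ x ∷ y ∷ [] → x ∷ y ∷ [] ⊆ L → ⊥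
    shrink x y L⊆ ⊆L = ¬separated₂ (x ∷ y ∷ []) ≤-refl (Separated-cong L⊆ ⊆L sep)
    a≢b : a ≢ b
    a≢b refl = shrink a c (λ { at0 → at0 ; at1 → at0 ; at2 → at1 }) (λ { at0 → at0 ; at1 → at2 })
    b≢c : b ≢ c
    b≢c refl = shrink a b (λ { at0 → at0 ; at1 → at1 ; at2 → at1 }) (λ { at0 → at0 ; at1 → at1 })
    a≢c : a ≢ c
    a≢c refl = shrink a b (λ { at0 → at0 ; at1 → at1 ; at2 → at0 }) (λ { at0 → at0 ; at1 → at1 })
    S≡3 : ∣ fromList L ∣ ≡ 3
    S≡3 = ≤-antisym (∣fromList∣≤length L) (≰⇒> λ S≤2 → none₂ (fromList L , asSubset sep , S≤2))
    clique : Clique (fromList L)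
    clique = decidable-stable (clique? (fromList L)) λ ¬clique → none₃ (fromList L , asSubset sep , S≡3 , ¬clique)
    triangle : a ∼ b × b ∼ c × a ∼ c
    triangle = clique a b (∈⟪⟫⁺ (_∈? L) at0) (∈⟪⟫⁺ (_∈? L) at1) a≢b
             , clique b c (∈⟪⟫⁺ (_∈? L) at1) (∈⟪⟫⁺ (_∈? L) at2) b≢c
             , clique a c (∈⟪⟫⁺ (_∈? L) at0) (∈⟪⟫⁺ (_∈? L) at2) a≢c

-- Sharpness

clamp : ∀ m → ℕ → Fin (suc m)
clamp m zero = zero
clamp zero (suc k) = zero
clamp (suc m) (suc k) = suc (clamp m k)

toℕ-clamp : ∀ {m k} → k ≤ m → toℕ (clamp m k) ≡ k
toℕ-clamp z≤n = refl
toℕ-clamp (s≤s k≤m) = cong suc (toℕ-clamp k≤m)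

-- The square of the cycle 1, 2, …, n − 1, plus the vertex 0 joined to 1, 2, 3
module Example (r : ℕ) where

  V : Set
  V = Fin (7 + r)

  last penultimate : V
  last = fromℕ (6 + r)
  penultimate = inject₁ (fromℕ (5 + r))

  pattern v0 = zero
  pattern v1 = suc v0
  pattern v2 = suc v1
  pattern v3 = suc v2
  pattern v4 = suc v3

  -- The first two lists form the square of the path on all vertices, which joins 0 to 1 and 2. The
  -- third adds the edge from 0 to 3 and the three edges that close the path from 1 onwards to the
  -- square of a cycle.
  arcs₁ arcs₂ arcs₃ arcs : List (V × V)
  arcs₁ = map (λ i → inject₁ i , suc i) (allFin (6 + r))
  arcs₂ = map (λ i → inject₁ (inject₁ i) , suc (suc i)) (allFin (5 + r))
  arcs₃ = (v0 , v3) ∷ (v1 , last) ∷ (v1 , penultimate) ∷ (v2 , last) ∷ []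
  arcs = arcs₁ ++ arcs₂ ++ arcs₃

  toℕ-last : toℕ last ≡ 6 + r
  toℕ-last = Finₚ.toℕ-fromℕ (6 + r)

  toℕ-penultimate : toℕ penultimate ≡ 5 + r
  toℕ-penultimate = trans (Finₚ.toℕ-inject₁ (fromℕ (5 + r))) (Finₚ.toℕ-fromℕ (5 + r))

  arcs₁⁻ : ∀ {u v} → (u , v) ∈ arcs₁ → toℕ v ≡ 1 + toℕ u
  arcs₁⁻ uv∈ with ∈-map⁻ (λ i → inject₁ i , suc i) uv∈
  ... | i , _ , refl = cong suc (sym (Finₚ.toℕ-inject₁ i))

  arcs₂⁻ : ∀ {u v} → (u , v) ∈ arcs₂ → toℕ v ≡ 2 + toℕ u
  arcs₂⁻ uv∈ with ∈-map⁻ (λ i → inject₁ (inject₁ i) , suc (suc i)) uv∈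
  ... | i , _ , refl = cong (2 +_) (sym (trans (Finₚ.toℕ-inject₁ (inject₁ i)) (Finₚ.toℕ-inject₁ i)))

  -- Differences of at least 3 keep these arcs apart from the other two lists, whose differences are
  -- 1 and 2, so that no edge is counted twice.
  arcs₃⁻ : ∀ {u v} → (u , v) ∈ arcs₃ → 3 + toℕ u ≤ toℕ v
  arcs₃⁻ at0 = ≤-refl
  arcs₃⁻ at1 = ≤-trans (m≤m+n 4 (2 + r)) (≤-reflexive (sym toℕ-last))
  arcs₃⁻ at2 = ≤-trans (m≤m+n 4 (1 + r)) (≤-reflexive (sym toℕ-penultimate))
  arcs₃⁻ at3 = ≤-trans (m≤m+n 5 (1 + r)) (≤-reflexive (sym toℕ-last))

  arcs⁻ : ∀ {u v} → (u , v) ∈ arcs → toℕ v ≡ 1 + toℕ u ⊎ toℕ v ≡ 2 + toℕ u ⊎ (u , v) ∈ arcs₃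
  arcs⁻ uv∈ with ∈-++⁻ arcs₁ uv∈
  ... | inj₁ uv∈₁ = inj₁ (arcs₁⁻ uv∈₁)
  ... | inj₂ uv∈′ with ∈-++⁻ arcs₂ uv∈′
  ...   | inj₁ uv∈₂ = inj₂ (inj₁ (arcs₂⁻ uv∈₂))
  ...   | inj₂ uv∈₃ = inj₂ (inj₂ uv∈₃)

  ascending : ∀ {u v} → (u , v) ∈ arcs → u Fin.< v
  ascending {u} uv∈ with arcs⁻ uv∈
  ... | inj₁ eq = ≤-reflexive (sym eq)
  ... | inj₂ (inj₁ eq) = ≤-trans (n≤1+n _) (≤-reflexive (sym eq))
  ... | inj₂ (inj₂ uv∈₃) = ≤-trans (m≤n+m _ 2) (arcs₃⁻ uv∈₃)

  arc₁ : ∀ {u v : V} → toℕ v ≡ 1 + toℕ u → (u , v) ∈ arcs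
  arc₁ {u} {suc i} eq = subst (λ z → (z , suc i) ∈ arcs)
    (toℕ-injective (trans (Finₚ.toℕ-inject₁ i) (suc-injective eq)))
    (∈-++⁺ˡ (∈-map⁺ (λ i → inject₁ i , suc i) (∈-allFin i)))

  arc₂ : ∀ {u v : V} → toℕ v ≡ 2 + toℕ u → (u , v) ∈ arcs
  arc₂ {u} {suc (suc i)} eq = subst (λ z → (z , suc (suc i)) ∈ arcs)
    (toℕ-injective (trans (trans (Finₚ.toℕ-inject₁ (inject₁ i)) (Finₚ.toℕ-inject₁ i)) (suc-injective (suc-injective eq))))
    (∈-++⁺ʳ arcs₁ (∈-++⁺ˡ (∈-map⁺ (λ i → inject₁ (inject₁ i) , suc (suc i)) (∈-allFin i))))

  arc₃ : ∀ {u v : V} → (u , v) ∈ arcs₃ → (u , v) ∈ arcs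
  arc₃ uv∈ = ∈-++⁺ʳ arcs₁ (∈-++⁺ʳ arcs₂ uv∈)

  G : Graph V
  G = record
    { _∼_ = λ u v → (u , v) ∈ arcs ⊎ (v , u) ∈ arcs
    ; _∼?_ = λ u v → ((u , v) ∈²? arcs) ⊎-dec ((v , u) ∈²? arcs)
    ; sym = [ inj₂ , inj₁ ]′
    ; irrefl = λ { refl → [ Finₚ.<-irrefl refl ∘ ascending , Finₚ.<-irrefl refl ∘ ascending ]′ }
    }
    where open DecMembership (≡-dec (Finₚ._≟_ {7 + r}) (Finₚ._≟_ {7 + r})) using () renaming (_∈?_ to _∈²?_)

  open Separation G

  connected : Connected G
  connected u v = proj₂ (from-zero u) ◅◅ proj₁ (from-zero v)
    where
    from-zero : ∀ v → Star _∼_ zero v × Star _∼_ v zero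
    from-zero = <-weakInduction (λ v → Star _∼_ zero v × Star _∼_ v zero) (ε , ε) λ i (to , from) →
      let arc = arc₁ {inject₁ i} {suc i} (cong suc (sym (Finₚ.toℕ-inject₁ i)))
      in to ◅◅ (inj₁ arc ◅ ε) , inj₂ arc ◅ from

  arcs-unique : Unique arcs
  arcs-unique = Uniqueₚ.++⁺ (Uniqueₚ.map⁺ (Finₚ.suc-injective ∘ cong proj₂) (Uniqueₚ.allFin⁺ (6 + r)))
    (Uniqueₚ.++⁺ (Uniqueₚ.map⁺ (Finₚ.suc-injective ∘ Finₚ.suc-injective ∘ cong proj₂) (Uniqueₚ.allFin⁺ (5 + r)))
      (((λ ()) ∷ (λ ()) ∷ (λ ()) ∷ []) ∷ ((λ eq → Finₚ.fromℕ≢inject₁ (cong proj₂ eq)) ∷ (λ ()) ∷ []) ∷ ((λ ()) ∷ []) ∷ [] ∷ [])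
      λ { (uv∈₂ , uv∈₃) → 1+n≰n (s≤s⁻¹ (s≤s⁻¹ (≤-trans (arcs₃⁻ uv∈₃) (≤-reflexive (arcs₂⁻ uv∈₂))))) })
    λ { {u , v} (uv∈₁ , uv∈) → disjoint₁ (arcs₁⁻ uv∈₁) (∈-++⁻ arcs₂ uv∈) }
    where
    disjoint₁ : ∀ {u v} → toℕ v ≡ 1 + toℕ u → (u , v) ∈ arcs₂ ⊎ (u , v) ∈ arcs₃ → ⊥
    disjoint₁ eq (inj₁ uv∈₂) = 1+n≢n (suc-injective (trans (sym (arcs₂⁻ uv∈₂)) eq))
    disjoint₁ eq (inj₂ uv∈₃) = 1+n≰n (≤-trans (n≤1+n _) (s≤s⁻¹ (≤-trans (arcs₃⁻ uv∈₃) (≤-reflexive eq))))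

  size≡ : size G ≡ 2 * (7 + r) + 1
  size≡ = trans (≤-antisym
    (length-Unique-⊆ (Uniqueₚ.filter⁺ edge? (Uniqueₚ.cartesianProduct⁺ (Uniqueₚ.allFin⁺ (7 + r)) (Uniqueₚ.allFin⁺ (7 + r)))) edge⇒arc)
    (length-Unique-⊆ arcs-unique arc⇒edge)) count
    where
    edge? : (uv : V × V) → Dec (proj₁ uv Fin.< proj₂ uv × proj₁ uv ∼ proj₂ uv)
    edge? (u , v) = (u Finₚ.<? v) ×-dec (u ∼? v)
    edge⇒arc : ∀ {uv} → uv ∈ edges G → uv ∈ arcs
    edge⇒arc {u , v} uv∈ with ∈-filter⁻ edge? {xs = cartesianProduct (allFin (7 + r)) (allFin (7 + r))} uv∈
    ... | _ , u<v , inj₁ uv∈arcs = uv∈arcs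
    ... | _ , u<v , inj₂ vu∈arcs = contradiction (ascending vu∈arcs) (Finₚ.<-asym u<v)
    arc⇒edge : ∀ {uv} → uv ∈ arcs → uv ∈ edges G
    arc⇒edge {u , v} uv∈ = ∈-filter⁺ edge? (∈-cartesianProduct⁺ (∈-allFin u) (∈-allFin v)) (ascending uv∈ , inj₁ uv∈)
    length-map-allFin : ∀ {A : Set} m (f : Fin m → A) → length (map f (allFin m)) ≡ m
    length-map-allFin m f = trans (length-map f (allFin m)) (length-tabulate {n = m} id)
    count : length arcs ≡ 2 * (7 + r) + 1
    count = begin
      length arcs                                    ≡⟨ trans (length-++ arcs₁) (cong (length arcs₁ +_) (length-++ arcs₂)) ⟩
      length arcs₁ + (length arcs₂ + 4)              ≡⟨ cong₂ (λ x y → x + (y + 4)) (length-map-allFin (6 + r) (λ i → inject₁ i , suc i))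
                                                          (length-map-allFin (5 + r) (λ i → inject₁ (inject₁ i) , suc (suc i))) ⟩
      (6 + r) + ((5 + r) + 4)                        ≡⟨ solve 1 (λ r → (con 6 :+ r) :+ ((con 5 :+ r) :+ con 4) := con 2 :* (con 7 :+ r) :+ con 1) refl r ⟩
      2 * (7 + r) + 1                                ∎
      where
      open ≡-Reasoning
      open +-*-Solver

  -- Truncation makes this total, so that positions along a walk can be computed as natural numbers;
  -- the range is checked in the lemmas.
  vertex : ℕ → V
  vertex = clamp (6 + r)

  vertex-toℕ : ∀ v → vertex (toℕ v) ≡ v
  vertex-toℕ v = toℕ-injective (toℕ-clamp (Finₚ.toℕ≤pred[n] v))

  step₁ : ∀ {k} → 1 + k ≤ 6 + r → vertex k ∼ vertex (1 + k)
  step₁ k< = inj₁ (arc₁ (trans (toℕ-clamp k<) (cong suc (sym (toℕ-clamp (<⇒≤ k<))))))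

  step₂ : ∀ {k} → 2 + k ≤ 6 + r → vertex k ∼ vertex (2 + k)
  step₂ k< = inj₁ (arc₂ (trans (toℕ-clamp k<) (cong (2 +_) (sym (toℕ-clamp (<⇒≤ (<⇒≤ k<)))))))

  module _ {S : Subset (7 + r)} (c : Split (_∈ˢ S)) where
    open Split c

    Gap : (ℕ → V) → ℕ → Set
    Gap f k = ∃[ p ] 0 < p × suc p ≤ k × f p ∈ˢ S × f (suc p) ∈ˢ S

    -- The invariant of a walk with steps of length 1 and 2: one of the last two vertices is in `I`,
    -- and if it is not the current one, that one belongs to `S`.
    Reaches : (ℕ → V) → ℕ → Set
    Reaches f k = I (f k) ⊎ ∃[ j ] k ≡ suc j × f k ∈ˢ S × I (f j)

    -- A walk through the square of a path can only leave I across two consecutive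
    -- vertices of S.
    scan : ∀ f m → (∀ {i} → 1 + i ≤ m → f i ∼ f (1 + i)) → (∀ {i} → 2 + i ≤ m → f i ∼ f (2 + i)) →
           I (f 0) → ∀ k → k ≤ m → Gap f k ⊎ Reaches f k
    scan f m f₁ f₂ If₀ zero _ = inj₂ (inj₁ If₀)
    scan f m f₁ f₂ If₀ (suc k) k<m with scan f m f₁ f₂ If₀ k (<⇒≤ k<m) | f (suc k) Subsetₚ.∈? S
    ... | inj₁ (p , 0<p , p<k , fp , fp′) | _ = inj₁ (p , 0<p , m≤n⇒m≤1+n p<k , fp , fp′)
    ... | inj₂ (inj₁ Ifk) | yes f∈ = inj₂ (inj₂ (k , refl , f∈ , Ifk))
    ... | inj₂ (inj₁ Ifk) | no f∉ =
      inj₂ (inj₁ ([ id , (λ Of → contradiction (f₁ k<m) (no-crossing Ifk Of)) ]′ (I∪O f∉)))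
    ... | inj₂ (inj₂ (j , refl , fk∈ , Ifj)) | yes f∈ = inj₁ (suc j , s≤s z≤n , ≤-refl , fk∈ , f∈)
    ... | inj₂ (inj₂ (j , refl , fk∈ , Ifj)) | no f∉ =
      inj₂ (inj₁ ([ id , (λ Of → contradiction (f₂ k<m) (no-crossing Ifj Of)) ]′ (I∪O f∉)))

    ascend : ∀ a → I (vertex a) → ∀ d → a + d ≤ 6 + r →
             Gap (λ i → vertex (a + i)) d ⊎ Reaches (λ i → vertex (a + i)) d
    ascend a Ia d a+d≤ = scan (λ i → vertex (a + i)) d
      (λ {i} i<d → subst (λ z → vertex (a + i) ∼ vertex z) (sym (+-suc a i))
        (step₁ (≤-trans (≤-reflexive (sym (+-suc a i))) (≤-trans (+-monoʳ-≤ a i<d) a+d≤))))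
      (λ {i} i<d → subst (λ z → vertex (a + i) ∼ vertex z) (sym (trans (+-suc a (suc i)) (cong suc (+-suc a i))))
        (step₂ (≤-trans (≤-reflexive (sym (trans (+-suc a (suc i)) (cong suc (+-suc a i))))) (≤-trans (+-monoʳ-≤ a i<d) a+d≤))))
      (subst (I ∘ vertex) (sym (+-identityʳ a)) Ia) d ≤-refl

    descend : ∀ a → a ≤ 6 + r → I (vertex a) → ∀ d → d ≤ a →
              Gap (λ i → vertex (a ∸ i)) d ⊎ Reaches (λ i → vertex (a ∸ i)) d
    descend a a≤ Ia d d≤a = scan (λ i → vertex (a ∸ i)) d
      (λ {i} i<d → let eq = sym (+-∸-assoc 1 (≤-trans i<d d≤a)) in
        ∼-sym (subst (λ z → vertex (a ∸ (1 + i)) ∼ vertex z) eq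
          (step₁ (≤-trans (≤-reflexive eq) (≤-trans (m∸n≤m a i) a≤)))))
      (λ {i} i<d → let eq = sym (+-∸-assoc 2 (≤-trans i<d d≤a)) in
        ∼-sym (subst (λ z → vertex (a ∸ (2 + i)) ∼ vertex z) eq
          (step₂ (≤-trans (≤-reflexive eq) (≤-trans (m∸n≤m a i) a≤)))))
      Ia d ≤-refl

  vertex-injective : ∀ {i j} → i ≤ 6 + r → j ≤ 6 + r → vertex i ≡ vertex j → i ≡ j
  vertex-injective i≤ j≤ eq = trans (sym (toℕ-clamp i≤)) (trans (cong toℕ eq) (toℕ-clamp j≤))

  vertex-last : last ≡ vertex (6 + r)
  vertex-last = toℕ-injective (trans toℕ-last (sym (toℕ-clamp {6 + r} ≤-refl)))

  vertex-penultimate : penultimate ≡ vertex (5 + r)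
  vertex-penultimate = toℕ-injective (trans toℕ-penultimate (sym (toℕ-clamp {6 + r} (n≤1+n (5 + r)))))

  -- Two positions on opposite sides of the cut split the cycle into two arcs, and each must contain
  -- two elements of `S`. The numbers `a′`, `d`, `e` are the distances from 1 to `a`, from `a` to
  -- `b` and from `b` to the last vertex; `outer` treats the arc that passes from the last vertex to
  -- 1.
  module TwoGaps {S : Subset (7 + r)} (c : Split (_∈ˢ S)) (a′ d e : ℕ)
    (a+d+e≡6+r : suc a′ + d + e ≡ 6 + r)
    (Ia : Split.I c (vertex (suc a′))) (Ob : Split.O c (vertex (suc a′ + d))) where
    open Split c

    a b : ℕ
    a = suc a′
    b = a + d

    b≤6+r : b ≤ 6 + r
    b≤6+r = ≤-trans (m≤m+n b e) (≤-reflexive a+d+e≡6+r)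

    a≤6+r : a ≤ 6 + r
    a≤6+r = ≤-trans (m≤m+n a d) b≤6+r

    inner : ∃[ i ] a < i × suc i < b × vertex i ∈ˢ S × vertex (suc i) ∈ˢ S
    inner with ascend c a Ia d b≤6+r
    ... | inj₁ (suc p , _ , p<d , i∈ , j∈) = a + suc p , m<m+n a (s≤s z≤n) ,
          ≤∧≢⇒< (≤-trans (≤-reflexive eq) (+-monoʳ-≤ a p<d))
            (λ 1+i≡b → O∩P Ob (subst (λ z → vertex z ∈ˢ S) (trans (sym eq) 1+i≡b) j∈)) ,
          i∈ , subst (λ z → vertex z ∈ˢ S) (sym eq) j∈
      where
      eq : suc (a + suc p) ≡ a + suc (suc p)
      eq = sym (+-suc a (suc p))
    ... | inj₂ (inj₁ Ib) = contradiction Ob (I∩O Ib)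
    ... | inj₂ (inj₂ (_ , _ , b∈ , _)) = contradiction b∈ (O∩P Ob)

    Out : ℕ → Set
    Out i = i ≤ 6 + r × (i < a ⊎ b < i) × vertex i ∈ˢ S

    Front Back : Set
    Front = I v1 ⊎ (v1 ∈ˢ S × I v2 × 1 < a)
    Back = O last ⊎ (last ∈ˢ S × O penultimate × b < 6 + r)

    front : Reaches c (λ i → vertex (a ∸ i)) a′ → Front
    front (inj₁ I1) = inj₁ (subst (I ∘ vertex) (m+n∸n≡m 1 a′) I1)
    front (inj₂ (j , a′≡ , 1∈ , I2)) = inj₂
      ( subst (λ z → vertex z ∈ˢ S) (m+n∸n≡m 1 a′) 1∈
      , subst (I ∘ vertex) (trans (cong (λ z → suc z ∸ j) a′≡) (m+n∸n≡m 2 j)) I2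
      , s≤s (subst (0 <_) (sym a′≡) (s≤s z≤n)) )

    back : Reaches (swap c) (λ i → vertex (b + i)) e → Back
    back (inj₁ OM) = inj₁ (subst O (trans (cong vertex a+d+e≡6+r) (sym vertex-last)) OM)
    back (inj₂ (j , e≡ , M∈ , OM′)) = inj₂
      ( subst (_∈ˢ S) (trans (cong vertex a+d+e≡6+r) (sym vertex-last)) M∈
      , subst O (trans (cong vertex (suc-injective 1+b+j≡6+r)) (sym vertex-penultimate)) OM′
      , ≤-trans (s≤s (m≤m+n b j)) (≤-reflexive 1+b+j≡6+r) )
      where
      1+b+j≡6+r : suc (b + j) ≡ 6 + r
      1+b+j≡6+r = trans (sym (+-suc b j)) (trans (cong (b +_) (sym e≡)) a+d+e≡6+r)

    -- The edges closing the cycle join 1 to the last two vertices and 2 to the last one. They rule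
    -- out every case but the one with both 1 and the last vertex in `S`; the strict bounds place
    -- these two outside the inner arc.
    seam : Front → Back → ∃[ i ] ∃[ j ] i ≢ j × Out i × Out j
    seam (inj₁ I1) (inj₁ OM) = contradiction (inj₁ (arc₃ at1)) (no-crossing I1 OM)
    seam (inj₁ I1) (inj₂ (_ , OM′ , _)) = contradiction (inj₁ (arc₃ at2)) (no-crossing I1 OM′)
    seam (inj₂ (_ , I2 , _)) (inj₁ OM) = contradiction (inj₁ (arc₃ at3)) (no-crossing I2 OM)
    seam (inj₂ (1∈ , _ , 1<a)) (inj₂ (M∈ , _ , b<M)) = 1 , 6 + r , (λ ()) ,
      (s≤s z≤n , inj₁ 1<a , 1∈) , (≤-refl , inj₂ b<M , subst (_∈ˢ S) vertex-last M∈)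

    outer : ∃[ i ] ∃[ j ] i ≢ j × Out i × Out j
    outer with ascend (swap c) b Ob e (≤-reflexive a+d+e≡6+r)
             | descend c a a≤6+r Ia a′ (n≤1+n a′)
    ... | inj₁ (suc p , _ , p<e , i∈ , j∈) | _ =
      b + suc p , b + suc (suc p) , (λ eq → 1+n≢n (sym (+-cancelˡ-≡ b _ _ eq))) ,
      (≤-trans (+-monoʳ-≤ b (<⇒≤ p<e)) (≤-reflexive a+d+e≡6+r) , inj₂ (m<m+n b (s≤s z≤n)) , i∈) ,
      (≤-trans (+-monoʳ-≤ b p<e) (≤-reflexive a+d+e≡6+r) , inj₂ (m<m+n b (s≤s z≤n)) , j∈)
    ... | inj₂ _ | inj₁ (suc p , _ , p<a′ , i∈ , j∈) =
      a′ ∸ p , a′ ∸ suc p , (λ eq → 1+n≢n (trans (sym (+-∸-assoc 1 (<⇒≤ p<a′))) eq)) ,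
      (≤-trans (m∸n≤m a′ p) (≤-trans (n≤1+n a′) a≤6+r) , inj₁ (s≤s (m∸n≤m a′ p)) , i∈) ,
      (≤-trans (m∸n≤m a′ (suc p)) (≤-trans (n≤1+n a′) a≤6+r) , inj₁ (s≤s (m∸n≤m a′ (suc p))) , j∈)
    ... | inj₂ up | inj₂ down = seam (front down) (back up)

  four-elements : ∀ {S} (c : Split (_∈ˢ S)) {a b : V} → 0 < toℕ a → toℕ a < toℕ b →
                  Split.I c a → Split.O c b → 4 ≤ ∣ S ∣
  four-elements {S} c {suc a} {b} _ a<b Ia Ob
    with m≤n⇒∃[o]m+o≡n (<⇒≤ a<b) | m≤n⇒∃[o]m+o≡n (Finₚ.toℕ≤pred[n] b)
  ... | d , a+d≡b | e , b+e≡6+r = collect inner outer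
    where
    open TwoGaps c (toℕ a) d e (trans (cong (_+ e) a+d≡b) b+e≡6+r)
      (subst (Split.I c) (sym (vertex-toℕ (suc a))) Ia)
      (subst (Split.O c) (sym (trans (cong vertex a+d≡b) (vertex-toℕ b))) Ob)
      renaming (a to A; b to B)
    In : ℕ → Set
    In i = A < i × i < B × vertex i ∈ˢ S
    ≢-vertex : ∀ {i j} → i ≤ 6 + r → j ≤ 6 + r → i ≢ j → vertex i ≢ vertex j
    ≢-vertex i≤ j≤ i≢j eq = i≢j (vertex-injective i≤ j≤ eq)
    In≤ : ∀ {i} → In i → i ≤ 6 + r
    In≤ (_ , i<B , _) = ≤-trans (<⇒≤ i<B) b≤6+r
    In≢Out : ∀ {i j} → In i → Out j → vertex i ≢ vertex j
    In≢Out In-i@(A<i , i<B , _) (j≤ , inj₁ j<A , _) = ≢-vertex (In≤ In-i) j≤ λ i≡j → <-asym A<i (subst (_< A) (sym i≡j) j<A)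
    In≢Out In-i@(A<i , i<B , _) (j≤ , inj₂ B<j , _) = ≢-vertex (In≤ In-i) j≤ λ i≡j → <-asym i<B (subst (B <_) (sym i≡j) B<j)
    collect : (∃[ i ] A < i × suc i < B × vertex i ∈ˢ S × vertex (suc i) ∈ˢ S) →
              (∃[ i ] ∃[ j ] i ≢ j × Out i × Out j) → 4 ≤ ∣ S ∣
    collect (i , A<i , 1+i<B , i∈ , 1+i∈) (k , l , k≢l , Out-k , Out-l) =
      length≤∣S∣ {L = vertex i ∷ vertex (suc i) ∷ vertex k ∷ vertex l ∷ []}
        ((≢-vertex (In≤ In-i) (In≤ In-1+i) (1+n≢n ∘ sym) ∷ In≢Out In-i Out-k ∷ In≢Out In-i Out-l ∷ []) ∷
         (In≢Out In-1+i Out-k ∷ In≢Out In-1+i Out-l ∷ []) ∷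
         (≢-vertex (proj₁ Out-k) (proj₁ Out-l) k≢l ∷ []) ∷ [] ∷ [])
        λ { at0 → i∈ ; at1 → 1+i∈ ; at2 → proj₂ (proj₂ Out-k) ; at3 → proj₂ (proj₂ Out-l) }
      where
      In-i : In i
      In-i = A<i , <⇒≤ 1+i<B , i∈
      In-1+i : In (suc i)
      In-1+i = m≤n⇒m≤1+n A<i , 1+i<B , 1+i∈

  hub : List V
  hub = v1 ∷ v2 ∷ v3 ∷ []

  zero-neighbour : ∀ {v} → zero ∼ v → v ∈ hub
  zero-neighbour (inj₂ arc) with () ← ascending arc
  zero-neighbour {v} (inj₁ arc) with arcs⁻ arc
  ... | inj₁ eq = here (toℕ-injective eq)
  ... | inj₂ (inj₁ eq) = there (here (toℕ-injective eq))
  ... | inj₂ (inj₂ at0) = at2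
  ... | inj₂ (inj₂ (there (here ())))
  ... | inj₂ (inj₂ (there (there (here ()))))
  ... | inj₂ (inj₂ (there (there (there (here ())))))

  hub-neighbour : ∀ {v} → v ∈ hub → zero ∼ v
  hub-neighbour at0 = inj₁ (arc₁ refl)
  hub-neighbour at1 = inj₁ (arc₂ refl)
  hub-neighbour at2 = inj₁ (arc₃ at0)

  hub-separated : Separated (_∈ˢ fromList hub)
  hub-separated = separate {A = _≡ zero} (Finₚ._≟ zero) {zero} {v4} refl
    ((λ { (here ()) ; (there (here ())) ; (there (there (here ()))) }) ∘ ∈⟪⟫⁻ (_∈? hub)) (λ ())
    ((λ { (here ()) ; (there (here ())) ; (there (there (here ()))) }) ∘ ∈⟪⟫⁻ (_∈? hub))
    λ { refl _ _ q∉ 0∼q → q∉ (∈⟪⟫⁺ (_∈? hub) (zero-neighbour 0∼q)) }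

  -- If a neighbour `t` of 0 avoids `S`, then it lies on the same side as 0 whenever 0 lies on a
  -- side. So both sides contain vertices of the cycle, and `four-elements` contradicts the size of
  -- `S`.
  Separated⇒hub⊆S : ∀ {S} → ∣ S ∣ ≤ 3 → Separated (_∈ˢ S) → ∀ {t} → t ∈ hub → t ∈ˢ S
  Separated⇒hub⊆S {S} S≤3 sep {t} t∈hub = decidable-stable (t Subsetₚ.∈? S) absurd
    where
    c = Separated⇒Split (Subsetₚ._∈? S) sep
    open Split c using (u; w; Iu; Ow; I∩O)
    nonzero : (c : Split (_∈ˢ S)) → t ∉ˢ S → ∀ v → Split.I c v → ∃[ v′ ] 0 < toℕ v′ × Split.I c v′
    nonzero c t∉S (suc v) Iv = suc v , s≤s z≤n , Iv
    nonzero c t∉S zero I0 = t , ascending′ t∈hub , [ id , (λ Ot → contradiction (hub-neighbour t∈hub) (no-crossing I0 Ot)) ]′ (I∪O t∉S)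
      where
      open Split c using (I∪O; no-crossing)
      ascending′ : ∀ {t} → t ∈ hub → 0 < toℕ t
      ascending′ at0 = s≤s z≤n
      ascending′ at1 = s≤s z≤n
      ascending′ at2 = s≤s z≤n
    absurd : t ∉ˢ S → ⊥
    absurd t∉S with nonzero c t∉S u Iu | nonzero (swap c) t∉S w Ow
    ... | a , 0<a , Ia | b , 0<b , Ob with Finₚ.<-cmp a b
    ...   | tri< a<b _ _ = <⇒≱ (four-elements c 0<a a<b Ia Ob) S≤3
    ...   | tri≈ _ refl _ = I∩O Ia Ob
    ...   | tri> _ _ b<a = <⇒≱ (four-elements (swap c) 0<b b<a Ob Ia) S≤3

  -- The neighbourhood of 0 is a cut of three vertices, so a minimum cut has at most three elements,
  -- contains this neighbourhood, and with it a triangle.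
  ¬foresty : ¬ HasForestyMinimumVertexCut G
  ¬foresty (S , (cut , _ , least) , _ , forest) = forest record
    { k = 0
    ; c = λ i → suc (i Fin.↑ˡ (3 + r)) , hub⊆S (∈hub i)
    ; distinct = λ {i} {j} eq → Finₚ.↑ˡ-injective (3 + r) i j (Finₚ.suc-injective (cong proj₁ eq))
    ; steps = λ { zero → inj₁ (arc₁ refl) ; (suc zero) → inj₁ (arc₁ refl) }
    ; closing = inj₂ (arc₂ refl) }
    where
    S≤3 : ∣ S ∣ ≤ 3
    S≤3 = ≤-trans (least (fromList hub) (inj₁ (Separated⇒IsVertexCut (fromList hub) hub-separated))) (∣fromList∣≤length hub)
    hub⊆S : ∀ {t} → t ∈ hub → t ∈ˢ S
    hub⊆S = Separated⇒hub⊆S S≤3 (IsVertexCut⇒Separated S cut)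
    ∈hub : ∀ (i : Fin 3) → suc (i Fin.↑ˡ (3 + r)) ∈ hub
    ∈hub zero = at0
    ∈hub (suc zero) = at1
    ∈hub (suc (suc zero)) = at2

theorem4 : (n : ℕ) → 7 ≤ n →
    ((G : Graph (Fin n)) → Connected G → size G ≤ 2 * n → HasForestyMinimumVertexCut G)
    × (Σ[ G ∈ Graph (Fin n) ] (Connected G × size G ≡ 2 * n + 1 × ¬ HasForestyMinimumVertexCut G))
theorem4 n 7≤n = (λ G _ → small-size⇒foresty G 7≤n) , example (m≤n⇒∃[o]m+o≡n 7≤n)
  where
  example : ∃[ r ] 7 + r ≡ n → Σ[ G ∈ Graph (Fin n) ] (Connected G × size G ≡ 2 * n + 1 × ¬ HasForestyMinimumVertexCut G)
  example (r , refl) = Example.G r , Example.connected r , Example.size≡ r , Example.¬foresty r
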